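{- There exist an absolute constant $C>0$ and infinitely many positive integers $n$ for which there is an order-$n$ Latin square $L$ such that every empty cube of $L$ has side at most $C (n\log n)^{1/2}$.
   Context: Write $[n]=\{1,\dots,n\}$. An order-$n$ Latin square is a map $L:[n]\times[n]\to[n]$ such that for each fixed $i$ the map $j\mapsto L(i,j)$ is a bijection and for each fixed $j$ the map $i\mapsto L(i,j)$ is a bijection. For $X,Y,Z\subseteq[n]$, the box $X\times Y\times Z$ is called an empty box of $L$ if there are no $i\in X$, $j\in Y$ with $L(i,j)\in Z$. A cube is a box $X\times Y\times Z$ with $|X|=|Y|=|Z|$; its side is this common cardinality. -}

module Defs where

open import Data.Nat using (ℕ; _*_; _≤_)
open import Data.Nat.Logarithm using (⌊log₂_⌋)
open import Data.Fin using (Fin)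
open import Data.Fin.Subset using (Subset; _∈_; _∉_; ∣_∣)
open import Data.Product using (_×_)
open import Function.Definitions using (Bijective)
open import Relation.Binary.PropositionalEquality using (_≡_)

record LatinSquare (n : ℕ) : Set where
  field
    entry  : Fin n → Fin n → Fin n
    rowBij : ∀ i → Bijective _≡_ _≡_ (λ j → entry i j)
    colBij : ∀ j → Bijective _≡_ _≡_ (λ i → entry i j)
open LatinSquare public

EmptyBox : ∀ {n} → LatinSquare n → Subset n → Subset n → Subset n → Set
EmptyBox L X Y Z = ∀ i j → i ∈ X → j ∈ Y → entry L i j ∉ Z

IsCube : ∀ {n} → Subset n → Subset n → Subset n → Set
IsCube X Y Z = (∣ X ∣ ≡ ∣ Y ∣) × (∣ Y ∣ ≡ ∣ Z ∣)

-- Natural-number rendering of "side ≤ C (n log n)^{1/2}" with a constant C: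
-- side² ≤ C · n · ⌊log₂ n⌋.
SideBound : ℕ → ℕ → ℕ → Set
SideBound C n s = s * s ≤ C * (n * ⌊log₂ n ⌋)

module Submission where

-- The points are F × F with F = ℤ/p, so n = p². Each non-vertical line carries an
-- idempotent quasigroup chosen independently, and these are glued: the product of two
-- points is formed on the line joining them. The quasigroup with parameters (t , c) is
-- the affine one (1 - c) a + c b conjugated by a ↦ (a - t)⁻¹. Two triples of points of F
-- are products for at most two common parameters, so three disjoint sets of k points of
-- a line form an empty box with probability at most about 1 - k³/2p.
-- Three disjoint sets of 2kp points leave k points each on at least half of the p²
-- lines, so they form an empty box with probability exp(-Ω(k³p)). There are only
-- exp(O(kp log n)) choices of the three sets, and k of order √(log n) suffices.

open import Defs
open import Data.Nat using (ℕ; zero; suc; NonZero; z≤n; s≤s; _≤_; _>_)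
import Data.Nat as ℕ
import Data.Nat.Properties as ℕ
import Data.Nat.DivMod as ℕ
import Data.Nat.Divisibility as ℕ∣
import Data.Nat.Tactic.RingSolver as ℕSolver
open import Data.Nat.Coprimality using (prime⇒coprime; coprime-Bézout)
open import Data.Nat.GCD using (module Bézout)
open import Data.Nat.Primality using (Prime; prime⇒nonZero; prime⇒nonTrivial; ¬prime[1])
import Data.Integer as ℤ
import Data.Integer.Properties as ℤ
open import Data.Bool using (if_then_else_; true; false)
open import Data.Fin using (Fin; zero; suc; toℕ; fromℕ<; combine; remQuot; quotient; finToFun; funToFin; _↑ˡ_; _↑ʳ_)
import Data.Fin.Properties as Fin
open import Data.Fin.Properties using (any?; all?)
open import Data.Fin.Subset using (Subset; _∈_; ∣_∣)
open import Data.Fin.Subset.Properties using (_∈?_)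
open import Data.Maybe as Maybe using (Maybe)
open import Data.Product using (Σ; ∃; _×_; _,_; proj₁; proj₂)
open import Data.Sum using (_⊎_; inj₁; inj₂)
open import Function using (_∘_)
open import Function.Definitions using (Injective; Bijective)
open import Level using (0ℓ)
open import Relation.Nullary using (Dec; yes; no; does; ¬_; contradiction)
open import Relation.Nullary.Decidable using (_×-dec_; _→-dec_; ¬?; map′; dec⇒maybe)
open import Relation.Unary using (Decidable)
open import Relation.Binary.PropositionalEquality hiding ([_])
open import Algebra.Bundles using (CommutativeRing)
open import Algebra.Solver.Ring.AlmostCommutativeRing using (fromCommutativeRing; _-Raw-AlmostCommutative⟶_)
import Algebra.Solver.Ring
open import Algebra.Properties.CommutativeMonoid.Sum ℕ.+-0-commutativeMonoid
  using (sum; sum-cong-≗; ∑-distrib-+; ∑-comm)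
open import Algebra.Properties.Semiring.Sum ℕ.+-*-semiring using (*-distribˡ-sum; *-distribʳ-sum)

-- Plain affine quasigroups `(1 - c) a + c b` would not do: whether `z` is the product of `a` and
-- `b` depends only on the ratio `(z - a) / (b - a)`, so triples of equal ratio are hit together,
-- and sets such as progressions have far fewer ratios than triples. The affine operation commutes
-- with translations and dilations; inversion with pole `t` breaks this symmetry and supplies the
-- second parameter. Idempotence is what permits gluing: the product of two distinct points differs
-- from its factors, so the line can be recovered from one factor and the product, and division
-- takes place on the same line. The second-order term in the count of hits stays below the first
-- only if `k³` is small against `p`; as `k` is of order `√(log n)`, this holds for large `p`. The
-- probabilistic argument is run as exact counting: probabilities are multiplied by powers of `n`,
-- and repeated halving replaces the exponential function.

module Counting where
  open import Data.Nat
  open import Data.Nat.Properties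
  open import Data.Nat.Tactic.RingSolver using (solve-∀)
  open import Data.Vec using ([]; _∷_)
  open import Data.Vec.Functional using (foldr)

  -- Indicators, finite sums and counting.

  𝟙 : {A : Set} → Dec A → ℕ
  𝟙 d = if does d then 1 else 0

  𝟙-yes : {A : Set} (d : Dec A) → A → 𝟙 d ≡ 1
  𝟙-yes (yes _) _ = refl
  𝟙-yes (no ¬a) a = contradiction a ¬a

  𝟙-no : {A : Set} (d : Dec A) → ¬ A → 𝟙 d ≡ 0
  𝟙-no (yes a) ¬a = contradiction a ¬a
  𝟙-no (no _)  _  = refl

  𝟙≤1 : {A : Set} (d : Dec A) → 𝟙 d ≤ 1
  𝟙≤1 (yes _) = ≤-refl
  𝟙≤1 (no _)  = z≤n

  𝟙≤ : {A : Set} (d : Dec A) {n : ℕ} → (A → 1 ≤ n) → 𝟙 d ≤ n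
  𝟙≤ (yes a) f = f a
  𝟙≤ (no _)  _ = z≤n

  𝟙-mono : {A B : Set} (a : Dec A) (b : Dec B) → (A → B) → 𝟙 a ≤ 𝟙 b
  𝟙-mono a b f = 𝟙≤ a (λ x → ≤-reflexive (sym (𝟙-yes b (f x))))

  𝟙-∪ : {A B C : Set} (a : Dec A) (b : Dec B) (c : Dec C) → (A → B ⊎ C) → 𝟙 a ≤ 𝟙 b + 𝟙 c
  𝟙-∪ a b c f = 𝟙≤ a λ x → cover (f x)
    where
    cover : _ → 1 ≤ 𝟙 b + 𝟙 c
    cover (inj₁ y) = ≤-trans (≤-reflexive (sym (𝟙-yes b y))) (m≤m+n _ _)
    cover (inj₂ z) = ≤-trans (≤-reflexive (sym (𝟙-yes c z))) (m≤n+m _ _)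

  𝟙-× : {A B : Set} (a : Dec A) (b : Dec B) → 𝟙 (a ×-dec b) ≡ 𝟙 a * 𝟙 b
  𝟙-× (yes _) (yes _) = refl
  𝟙-× (yes _) (no _)  = refl
  𝟙-× (no _)  _       = refl

  sum-mono : ∀ {n} {f g : Fin n → ℕ} → (∀ i → f i ≤ g i) → sum f ≤ sum g
  sum-mono {zero}  h = z≤n
  sum-mono {suc n} h = +-mono-≤ (h zero) (sum-mono (h ∘ suc))

  sum-const : ∀ n c → sum {n} (λ _ → c) ≡ n * c
  sum-const zero    c = refl
  sum-const (suc n) c = cong (c +_) (sum-const n c)

  term≤sum : ∀ {n} (f : Fin n → ℕ) i → f i ≤ sum f
  term≤sum f zero    = m≤m+n _ _
  term≤sum f (suc i) = ≤-trans (term≤sum (f ∘ suc) i) (m≤n+m _ _)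

  sum-↑ : ∀ m {n} (f : Fin (m + n) → ℕ) → sum f ≡ sum (λ i → f (i ↑ˡ n)) + sum (λ j → f (m ↑ʳ j))
  sum-↑ zero    f = refl
  sum-↑ (suc m) f = trans (cong (f zero +_) (sum-↑ m (f ∘ suc))) (sym (+-assoc (f zero) _ _))

  sum-combine : ∀ m n (f : Fin (m * n) → ℕ) → sum f ≡ sum {m} (λ i → sum {n} (λ j → f (combine i j)))
  sum-combine zero    n f = refl
  sum-combine (suc m) n f = trans (sum-↑ n f) (cong (sum (λ j → f (j ↑ˡ (m * n))) +_) (sum-combine m n (λ j → f (n ↑ʳ j))))

  sum-remQuot : ∀ m n (f : Fin m × Fin n → ℕ) → sum (λ i → f (remQuot {m} n i)) ≡ sum {m} (λ i → sum {n} (λ j → f (i , j)))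
  sum-remQuot m n f = trans (sum-combine m n _) (sum-cong-≗ (λ i → sum-cong-≗ (λ j → cong f (Fin.remQuot-combine i j))))

  count : ∀ {n} {P : Fin n → Set} → Decidable P → ℕ
  count P? = sum (λ i → 𝟙 (P? i))

  count≤n : ∀ {n} {P : Fin n → Set} (P? : Decidable P) → count P? ≤ n
  count≤n {n} P? = ≤-trans (sum-mono (𝟙≤1 ∘ P?)) (≤-reflexive (trans (sum-const n 1) (*-identityʳ n)))

  count-¬ : ∀ {n} {P : Fin n → Set} (P? : Decidable P) → count P? + count (¬? ∘ P?) ≡ n
  count-¬ {n} P? = trans (sym (∑-distrib-+ {n} _ _))
    (trans (sum-cong-≗ {n} (λ i → one (P? i))) (trans (sum-const n 1) (*-identityʳ n)))
    where
    one : {A : Set} (d : Dec A) → 𝟙 d + 𝟙 (¬? d) ≡ 1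
    one (yes _) = refl
    one (no _)  = refl

  count-≡ : ∀ {n} (x : Fin n) → count (Fin._≟ x) ≡ 1
  count-≡ {suc n} zero    = cong suc (trans (sum-const n 0) (*-zeroʳ n))
  count-≡ {suc n} (suc x) = count-≡ x

  count>0⇒∃ : ∀ {n} {P : Fin n → Set} (P? : Decidable P) → 1 ≤ count P? → ∃ P
  count>0⇒∃ {n} P? pos with any? P?
  ... | yes p = p
  ... | no ¬p = contradiction pos (<⇒≱ (s≤s (≤-reflexive
    (trans (sum-cong-≗ (λ i → 𝟙-no (P? i) (λ p → ¬p (i , p)))) (trans (sum-const n 0) (*-zeroʳ n))))))

  -- A greedy form of Hall's theorem.
  distinct-representatives : ∀ {n} m {P : Fin m → Fin n → Set} (P? : ∀ i → Decidable (P i)) →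
    (∀ i → m ≤ count (P? i)) → Σ (Fin m → Fin n) λ f → Injective _≡_ _≡_ f × (∀ i → P i (f i))
  distinct-representatives zero P? big = (λ ()) , (λ { {()} }) , λ ()
  distinct-representatives {n} (suc m) {P} P? big = f , f-inj , f-P
    where
    first = count>0⇒∃ (P? zero) (≤-trans (s≤s z≤n) (big zero))
    x = proj₁ first
    P′? : ∀ i → Decidable (λ y → P (suc i) y × y ≢ x)
    P′? i y = P? (suc i) y ×-dec ¬? (y Fin.≟ x)
    big′ : ∀ i → m ≤ count (P′? i)
    big′ i = +-cancelʳ-≤ 1 m _ (begin
      m + 1                            ≡⟨ +-comm m 1 ⟩
      suc m                            ≤⟨ big (suc i) ⟩
      count (P? (suc i))               ≤⟨ sum-mono (λ y → 𝟙-∪ (P? (suc i) y) (P′? i y) (y Fin.≟ x) (λ p → split p (y Fin.≟ x))) ⟩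
      sum (λ y → 𝟙 (P′? i y) + 𝟙 (y Fin.≟ x)) ≡⟨ ∑-distrib-+ {n} _ _ ⟩
      count (P′? i) + count (Fin._≟ x) ≡⟨ cong (count (P′? i) +_) (count-≡ x) ⟩
      count (P′? i) + 1                ∎)
      where
      open ≤-Reasoning
      split : ∀ {y} → P (suc i) y → Dec (y ≡ x) → (P (suc i) y × y ≢ x) ⊎ y ≡ x
      split p (yes e) = inj₂ e
      split p (no ¬e) = inj₁ (p , ¬e)
    rest = distinct-representatives m P′? big′
    f : Fin (suc m) → Fin n
    f zero    = x
    f (suc i) = proj₁ rest i
    f-inj : Injective _≡_ _≡_ f
    f-inj {zero}  {zero}  _ = refl
    f-inj {zero}  {suc j} e = contradiction (sym e) (proj₂ (proj₂ (proj₂ rest) j))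
    f-inj {suc i} {zero}  e = contradiction e (proj₂ (proj₂ (proj₂ rest) i))
    f-inj {suc i} {suc j} e = cong suc (proj₁ (proj₂ rest) e)
    f-P : ∀ i → P i (f i)
    f-P zero    = proj₂ first
    f-P (suc i) = proj₁ (proj₂ (proj₂ rest) i)

  count≤-distinct : ∀ {n} b {P : Fin n → Set} (P? : Decidable P) →
    (∀ (f : Fin (suc b) → Fin n) → Injective _≡_ _≡_ f → ¬ (∀ i → P (f i))) → count P? ≤ b
  count≤-distinct b P? none with count P? ≤? b
  ... | yes p = p
  ... | no ¬p = let f , inj , p = distinct-representatives (suc b) (λ _ → P?) (λ _ → ≰⇒> ¬p)
                in contradiction p (none f inj)

  -- Products, conditional expectations and moment inequalities.

  prod : ∀ {n} → (Fin n → ℕ) → ℕ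
  prod = foldr _*_ 1

  prod≤ : ∀ {n} M (w : Fin n → ℕ) → (∀ i → w i ≤ M) → prod w ≤ M ^ n
  prod≤ {zero}  M w w≤M = ≤-refl
  prod≤ {suc n} M w w≤M = *-mono-≤ (w≤M zero) (prod≤ M (w ∘ suc) (w≤M ∘ suc))

  -- The factor `M ^ g` on the left stands in for the exponent `n - g`: `g` of the good factors are
  -- bounded by `W`, the remaining ones by `M`.
  prod-≤-count : ∀ {n} M W (w : Fin n → ℕ) {G : Fin n → Set} (G? : Decidable G) g →
    (∀ i → w i ≤ M) → (∀ i → G i → w i ≤ W) → g ≤ count G? → prod w * M ^ g ≤ W ^ g * M ^ n
  prod-≤-count {n} M W w G? zero w≤M w≤W g≤ = begin
    prod w * 1  ≡⟨ *-identityʳ _ ⟩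
    prod w      ≤⟨ prod≤ M w w≤M ⟩
    M ^ n       ≡⟨ sym (+-identityʳ _) ⟩
    1 * M ^ n   ∎
    where open ≤-Reasoning
  prod-≤-count {suc n} M W w G? (suc g) w≤M w≤W g≤ with G? zero
  ... | yes p = begin
    (w zero * prod (w ∘ suc)) * (M * M ^ g) ≡⟨ interchange (w zero) _ M _ ⟩
    (w zero * M) * (prod (w ∘ suc) * M ^ g) ≤⟨ *-mono-≤ (*-monoˡ-≤ M (w≤W zero p))
        (prod-≤-count M W (w ∘ suc) (G? ∘ suc) g (w≤M ∘ suc) (w≤W ∘ suc) (s≤s⁻¹ g≤)) ⟩
    (W * M) * (W ^ g * M ^ n)               ≡⟨ interchange W M (W ^ g) _ ⟩
    (W * W ^ g) * (M * M ^ n)               ∎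
    where
    open ≤-Reasoning
    interchange : ∀ a b c d → (a * b) * (c * d) ≡ (a * c) * (b * d)
    interchange = [m*n]*[o*p]≡[m*o]*[n*p]
  ... | no _  = begin
    (w zero * prod (w ∘ suc)) * (M * M ^ g) ≡⟨ *-assoc (w zero) _ _ ⟩
    w zero * (prod (w ∘ suc) * M ^ suc g)   ≤⟨ *-mono-≤ (w≤M zero)
        (prod-≤-count M W (w ∘ suc) (G? ∘ suc) (suc g) (w≤M ∘ suc) (w≤W ∘ suc) g≤) ⟩
    M * (W ^ suc g * M ^ n)                 ≡⟨ x∙yz≈y∙xz M (W ^ suc g) _ ⟩
    W ^ suc g * (M * M ^ n)                 ∎
    where
    open ≤-Reasoning
    open import Algebra.Properties.CommutativeSemigroup *-commutativeSemigroup using (x∙yz≈y∙xz)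

  -- The method of conditional expectations: f is chosen one coordinate at a
  -- time so that the expected number of requirements missed stays below 1.
  hitting-choice : ∀ {K M} N {Alive : Fin K → Set} (alive? : Decidable Alive)
    {Hit : Fin K → Fin N → Fin M → Set} (hit? : ∀ u ℓ → Decidable (Hit u ℓ)) →
    sum (λ u → 𝟙 (alive? u) * prod (λ ℓ → count (¬? ∘ hit? u ℓ))) < M ^ N →
    Σ (Fin N → Fin M) λ f → ∀ u → Alive u → ∃ λ ℓ → Hit u ℓ (f ℓ)
  hitting-choice zero alive? hit? small = (λ ()) , λ u a → contradiction
    (≤-trans (≤-reflexive (sym (trans (*-identityʳ _) (𝟙-yes (alive? u) a)))) (term≤sum _ u)) (<⇒≱ small)
  hitting-choice {K} {M} (suc N) {Alive} alive? {Hit} hit? small = f , f-hits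
    where
    R : Fin K → ℕ
    R u = prod (λ ℓ → count (¬? ∘ hit? u (suc ℓ)))
    alive′? : ∀ c → Decidable (λ u → Alive u × ¬ Hit u zero c)
    alive′? c u = alive? u ×-dec ¬? (hit? u zero c)
    Φ : Fin M → ℕ
    Φ c = sum (λ u → 𝟙 (alive′? c u) * R u)
    ΣΦ : sum Φ ≡ sum (λ u → 𝟙 (alive? u) * (count (¬? ∘ hit? u zero) * R u))
    ΣΦ = begin
      sum (λ c → sum (λ u → 𝟙 (alive′? c u) * R u))
        ≡⟨ ∑-comm (λ c u → 𝟙 (alive′? c u) * R u) ⟩
      sum (λ u → sum (λ c → 𝟙 (alive′? c u) * R u))
        ≡⟨ sum-cong-≗ (λ u → sym (*-distribʳ-sum (R u) (λ c → 𝟙 (alive′? c u)))) ⟩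
      sum (λ u → sum (λ c → 𝟙 (alive′? c u)) * R u)
        ≡⟨ sum-cong-≗ (λ u → cong (_* R u) (sum-cong-≗ (λ c → 𝟙-× (alive? u) (¬? (hit? u zero c))))) ⟩
      sum (λ u → sum (λ c → 𝟙 (alive? u) * 𝟙 (¬? (hit? u zero c))) * R u)
        ≡⟨ sum-cong-≗ (λ u → cong (_* R u) (sym (*-distribˡ-sum (𝟙 (alive? u)) (λ c → 𝟙 (¬? (hit? u zero c)))))) ⟩
      sum (λ u → 𝟙 (alive? u) * count (¬? ∘ hit? u zero) * R u)
        ≡⟨ sum-cong-≗ (λ u → *-assoc (𝟙 (alive? u)) _ (R u)) ⟩
      sum (λ u → 𝟙 (alive? u) * (count (¬? ∘ hit? u zero) * R u)) ∎
      where open ≡-Reasoning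
    -- Averaging: the `M` values of `Φ` add up to the old potential, which is below `M * M ^ N`.
    good : ∃ λ c → Φ c < M ^ N
    good with any? (λ c → Φ c <? M ^ N)
    ... | yes p = p
    ... | no ¬p = contradiction (subst (_< M ^ suc N) (sym ΣΦ) small) (≤⇒≯ (≤-trans
      (≤-reflexive (sym (sum-const M (M ^ N)))) (sum-mono (λ c → ≮⇒≥ (λ q → ¬p (c , q))))))
    rest = hitting-choice N (alive′? (proj₁ good)) (λ u ℓ → hit? u (suc ℓ)) (proj₂ good)
    f : Fin (suc N) → Fin M
    f zero    = proj₁ good
    f (suc ℓ) = proj₁ rest ℓ
    f-hits : ∀ u → Alive u → ∃ λ ℓ → Hit u ℓ (f ℓ)
    f-hits u a with hit? u zero (proj₁ good)
    ... | yes h = zero , h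
    ... | no ¬h = let ℓ , h = proj₂ rest u (a , ¬h) in suc ℓ , h

  -- At a point lying in some event `e₀`, every other event there is charged to its ordered pair
  -- with `e₀`. Summing over all ordered pairs costs only a constant factor in the correction term.
  bonferroni : ∀ {κ M} r b {E : Fin κ → Fin M → Set} (E? : ∀ e → Decidable (E e)) {H : Fin M → Set} (H? : Decidable H) →
    (∀ e m → E e m → H m) → (∀ e → r ≤ count (E? e)) →
    (∀ e e′ → e ≢ e′ → count (λ m → E? e m ×-dec E? e′ m) ≤ b) →
    κ * r ≤ count H? + κ * (κ * b)
  bonferroni {κ} {M} r b {E} E? {H} H? E⊆H large small = begin
    κ * r                                    ≡⟨ sym (sum-const κ r) ⟩
    sum {κ} (λ _ → r)                        ≤⟨ sum-mono large ⟩
    sum (λ e → count (E? e))                 ≡⟨ ∑-comm (λ e m → 𝟙 (E? e m)) ⟩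
    sum (λ m → sum (λ e → 𝟙 (E? e m)))       ≤⟨ sum-mono pointwise ⟩
    sum (λ m → 𝟙 (H? m) + sum (λ e → sum (λ e′ → pair e e′ m))) ≡⟨ ∑-distrib-+ {M} _ _ ⟩
    count H? + sum (λ m → sum (λ e → sum (λ e′ → pair e e′ m)))
      ≡⟨ cong (count H? +_) (trans (∑-comm (λ m e → sum (λ e′ → pair e e′ m)))
           (sum-cong-≗ (λ e → ∑-comm (λ m e′ → pair e e′ m)))) ⟩
    count H? + sum (λ e → sum (λ e′ → sum (pair e e′)))
      ≤⟨ +-monoʳ-≤ (count H?) (sum-mono (λ e → sum-mono (bound e))) ⟩
    count H? + sum {κ} (λ e → sum {κ} (λ e′ → b))
      ≡⟨ cong (count H? +_) (trans (sum-cong-≗ {κ} (λ e → sum-const κ b)) (sum-const κ (κ * b))) ⟩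
    count H? + κ * (κ * b)                   ∎
    where
    open ≤-Reasoning
    pair? : ∀ e e′ m → Dec (e ≢ e′ × E e m × E e′ m)
    pair? e e′ m = ¬? (e Fin.≟ e′) ×-dec (E? e m ×-dec E? e′ m)
    pair : Fin κ → Fin κ → Fin M → ℕ
    pair e e′ m = 𝟙 (pair? e e′ m)
    bound : ∀ e e′ → sum (pair e e′) ≤ b
    bound e e′ with e Fin.≟ e′
    ... | yes e≡ = ≤-trans (≤-reflexive (trans (sum-const M 0) (*-zeroʳ M))) z≤n
    ... | no  e≢ = small e e′ e≢
    pointwise : ∀ m → sum (λ e → 𝟙 (E? e m)) ≤ 𝟙 (H? m) + sum (λ e → sum (λ e′ → pair e e′ m))
    pointwise m with any? (λ e → E? e m)
    ... | no ¬p = ≤-trans (≤-reflexive (trans (sum-cong-≗ (λ e → 𝟙-no (E? e m) (λ p → ¬p (e , p))))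
                    (trans (sum-const κ 0) (*-zeroʳ κ)))) z≤n
    ... | yes (e₀ , p₀) = begin
      sum (λ e → 𝟙 (E? e m))                       ≤⟨ sum-mono cover ⟩
      sum (λ e → 𝟙 (e Fin.≟ e₀) + sum (λ e′ → pair e e′ m)) ≡⟨ ∑-distrib-+ {κ} _ _ ⟩
      count (Fin._≟ e₀) + sum (λ e → sum (λ e′ → pair e e′ m))
        ≡⟨ cong (_+ sum (λ e → sum (λ e′ → pair e e′ m))) (trans (count-≡ e₀) (sym (𝟙-yes (H? m) (E⊆H e₀ m p₀)))) ⟩
      𝟙 (H? m) + sum (λ e → sum (λ e′ → pair e e′ m)) ∎
      where
      cover : ∀ e → 𝟙 (E? e m) ≤ 𝟙 (e Fin.≟ e₀) + sum (λ e′ → pair e e′ m)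
      cover e with e Fin.≟ e₀
      ... | yes _ = ≤-trans (𝟙≤1 (E? e m)) (m≤m+n 1 _)
      ... | no e≢ = ≤-trans (𝟙-mono (E? e m) (pair? e e₀ m) (λ p → e≢ , p , p₀))
                            (term≤sum (λ e′ → pair e e′ m) e₀)

  sum-* : ∀ {m n} (f : Fin m → ℕ) (g : Fin n → ℕ) → sum f * sum g ≡ sum (λ i → sum (λ j → f i * g j))
  sum-* f g = trans (*-distribʳ-sum (sum g) f) (sum-cong-≗ (λ i → *-distribˡ-sum (f i) g))

  2mn≤m²+n² : ∀ m n → 2 * (m * n) ≤ m * m + n * n
  2mn≤m²+n² m n with ≤-total m n
  ... | inj₁ m≤n = subst (λ n → 2 * (m * n) ≤ m * m + n * n) (m+[n∸m]≡n m≤n)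
    (subst (2 * (m * (m + (n ∸ m))) ≤_) (eq m (n ∸ m)) (m≤m+n _ _))
    where
    eq : ∀ m d → 2 * (m * (m + d)) + d * d ≡ m * m + (m + d) * (m + d)
    eq = solve-∀
  ... | inj₂ n≤m = subst (λ m → 2 * (m * n) ≤ m * m + n * n) (m+[n∸m]≡n n≤m)
    (subst (2 * ((n + (m ∸ n)) * n) ≤_) (eq n (m ∸ n)) (m≤m+n _ _))
    where
    eq : ∀ n d → 2 * ((n + d) * n) + d * d ≡ (n + d) * (n + d) + n * n
    eq = solve-∀

  -- This is `(a - 2 k)² ≥ k² 𝟙(a < k)` with the cross term moved to the left: the pointwise
  -- inequality behind Chebyshev's, for a variable of mean `2 k`.
  deviation : ∀ a k (a<?k : Dec (a < k)) → 4 * k * a + k * k * 𝟙 a<?k ≤ a * a + 4 * (k * k)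
  deviation a k (no _) = subst₂ _≤_ (eqˡ a k) (eqʳ a k) (2mn≤m²+n² a (2 * k))
    where
    eqˡ : ∀ a k → 2 * (a * (2 * k)) ≡ 4 * k * a + k * k * 0
    eqˡ = solve-∀
    eqʳ : ∀ a k → a * a + (2 * k) * (2 * k) ≡ a * a + 4 * (k * k)
    eqʳ = solve-∀
  deviation a k (yes a<k) = subst (λ k → 4 * k * a + k * k * 1 ≤ a * a + 4 * (k * k)) (m+[n∸m]≡n (<⇒≤ a<k))
    (subst ((4 * (a + (k ∸ a)) * a + (a + (k ∸ a)) * (a + (k ∸ a)) * 1) ≤_) (eq a (k ∸ a)) (m≤m+n _ _))
    where
    eq : ∀ a d → (4 * (a + d) * a + (a + d) * (a + d) * 1) + (2 * (a * d) + 3 * (d * d))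
           ≡ a * a + 4 * ((a + d) * (a + d))
    eq = solve-∀

  count-∈ : ∀ {n} (X : Subset n) → count (_∈? X) ≡ ∣ X ∣
  count-∈ []          = refl
  count-∈ (true ∷ X)  = cong suc (count-∈ X)
  count-∈ (false ∷ X) = count-∈ X

  injective? : ∀ {m n} (f : Fin m → Fin n) → Dec (Injective _≡_ _≡_ f)
  injective? f = map′ (λ inj {i} {j} → inj i j) (λ inj i j → inj)
    (all? λ i → all? λ j → (f i Fin.≟ f j) →-dec (i Fin.≟ j))

  finToFun-injective : ∀ {m n} {i j : Fin (m ^ n)} → (∀ k → finToFun {m} {n} i k ≡ finToFun j k) → i ≡ j
  finToFun-injective {m} {n} {i} {j} e =
    trans (sym (Fin.funToFin-finToFin {n} {m} i)) (trans (funToFin-cong n e) (Fin.funToFin-finToFin {n} {m} j))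
    where
    funToFin-cong : ∀ n {f g : Fin n → Fin m} → (∀ k → f k ≡ g k) → funToFin f ≡ funToFin g
    funToFin-cong zero    e = refl
    funToFin-cong (suc n) e = cong₂ combine (e zero) (funToFin-cong n (e ∘ suc))

open Counting

-- The field of residues modulo a prime.

module PrimeField (p : ℕ) (p-prime : Prime p) where
  open import Data.Integer using (ℤ; +_)
  open import Data.Integer.DivMod using (_%ℕ_; _/ℕ_; n%ℕd<d; a≡a%ℕn+[a/ℕn]*n)
  open import Data.Integer.Divisibility.Signed
    using (_∣_; divides; ∣⇒∣ᵤ; ∣m∣n⇒∣m+n; ∣m∣n⇒∣m-n; ∣n⇒∣m*n; ∣m⇒∣m*n; ∣m⇒∣-m)
  open import Data.Integer.Tactic.RingSolver using (solve-∀)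

  private instance
    p≢0 : NonZero p
    p≢0 = prime⇒nonZero p-prime

  -- With the residues themselves as elements, equality in the field is propositional and decidable,
  -- and sums over the field are sums over `Fin p`.
  F : Set
  F = Fin p

  ⟪_⟫ : F → ℤ
  ⟪ a ⟫ = + toℕ a

  [_] : ℤ → F
  [ i ] = fromℕ< (n%ℕd<d i p)

  []-⟪⟫ : ∀ a → [ ⟪ a ⟫ ] ≡ a
  []-⟪⟫ a = Fin.toℕ-injective (trans (Fin.toℕ-fromℕ< _) (ℕ.m<n⇒m%n≡m (Fin.toℕ<n a)))

  ⟪[]⟫ : ∀ i → + p ∣ ⟪ [ i ] ⟫ ℤ.- i
  ⟪[]⟫ i = divides (ℤ.- (i /ℕ p)) (begin
    ⟪ [ i ] ⟫ ℤ.- i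
      ≡⟨ cong₂ ℤ._-_ (cong +_ (Fin.toℕ-fromℕ< (n%ℕd<d i p))) (a≡a%ℕn+[a/ℕn]*n i p) ⟩
    + (i %ℕ p) ℤ.- (+ (i %ℕ p) ℤ.+ (i /ℕ p) ℤ.* + p)
      ≡⟨ cancel (+ (i %ℕ p)) (i /ℕ p) (+ p) ⟩
    ℤ.- (i /ℕ p) ℤ.* + p ∎)
    where
    open ≡-Reasoning
    cancel : ∀ r q d → r ℤ.- (r ℤ.+ q ℤ.* d) ≡ ℤ.- q ℤ.* d
    cancel = solve-∀

  -- Representatives lie between 0 and `p - 1`, so a difference divisible by `p` has absolute value
  -- below `p` and must vanish.
  ⟪⟫-unique : ∀ a b → + p ∣ ⟪ a ⟫ ℤ.- ⟪ b ⟫ → a ≡ b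
  ⟪⟫-unique a b d with ℤ.∣ ⟪ a ⟫ ℤ.- ⟪ b ⟫ ∣ in eq
  ... | zero  = Fin.toℕ-injective (ℤ.+-injective (ℤ.i-j≡0⇒i≡j ⟪ a ⟫ ⟪ b ⟫ (ℤ.∣i∣≡0⇒i≡0 eq)))
  ... | suc m = contradiction (ℕ∣.∣⇒≤ (subst (p ℕ∣.∣_) eq (∣⇒∣ᵤ d))) (ℕ.<⇒≱ (subst (ℕ._< p)
    (trans (cong ℤ.∣_∣ (sym (ℤ.m-n≡m⊖n (toℕ a) (toℕ b)))) eq)
    (ℕ.≤-<-trans (ℤ.∣m⊝n∣≤m⊔n (toℕ a) (toℕ b)) (ℕ.⊔-lub (Fin.toℕ<n a) (Fin.toℕ<n b)))))

  []-cong : ∀ i j → + p ∣ i ℤ.- j → [ i ] ≡ [ j ]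
  []-cong i j d = ⟪⟫-unique [ i ] [ j ]
    (subst (+ p ∣_) (telescope ⟪ [ i ] ⟫ i ⟪ [ j ] ⟫ j) (∣m∣n⇒∣m+n (∣m∣n⇒∣m-n (⟪[]⟫ i) (⟪[]⟫ j)) d))
    where
    telescope : ∀ r i s j → (r ℤ.- i) ℤ.- (s ℤ.- j) ℤ.+ (i ℤ.- j) ≡ r ℤ.- s
    telescope = solve-∀

  infixl 6 _+_ _-_
  infixl 7 _*_
  infix  8 -_

  -_ : F → F
  - a = [ ℤ.- ⟪ a ⟫ ]

  _+_ _*_ _-_ : F → F → F
  a + b = [ ⟪ a ⟫ ℤ.+ ⟪ b ⟫ ]
  a * b = [ ⟪ a ⟫ ℤ.* ⟪ b ⟫ ]
  a - b = a + - b

  0# 1# : F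
  0# = [ + 0 ]
  1# = [ + 1 ]

  []-+ : ∀ i j → [ i ℤ.+ j ] ≡ [ i ] + [ j ]
  []-+ i j = sym ([]-cong (⟪ [ i ] ⟫ ℤ.+ ⟪ [ j ] ⟫) (i ℤ.+ j) (subst (+ p ∣_) (regroup ⟪ [ i ] ⟫ i ⟪ [ j ] ⟫ j) (∣m∣n⇒∣m+n (⟪[]⟫ i) (⟪[]⟫ j))))
    where
    regroup : ∀ r i s j → (r ℤ.- i) ℤ.+ (s ℤ.- j) ≡ (r ℤ.+ s) ℤ.- (i ℤ.+ j)
    regroup = solve-∀

  []-* : ∀ i j → [ i ℤ.* j ] ≡ [ i ] * [ j ]
  []-* i j = sym ([]-cong (⟪ [ i ] ⟫ ℤ.* ⟪ [ j ] ⟫) (i ℤ.* j) (subst (+ p ∣_) (regroup ⟪ [ i ] ⟫ i ⟪ [ j ] ⟫ j)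
    (∣m∣n⇒∣m+n (∣m⇒∣m*n ⟪ [ j ] ⟫ (⟪[]⟫ i)) (∣n⇒∣m*n i (⟪[]⟫ j)))))
    where
    regroup : ∀ r i s j → (r ℤ.- i) ℤ.* s ℤ.+ i ℤ.* (s ℤ.- j) ≡ (r ℤ.* s) ℤ.- (i ℤ.* j)
    regroup = solve-∀

  []-neg : ∀ i → [ ℤ.- i ] ≡ - [ i ]
  []-neg i = sym ([]-cong (ℤ.- ⟪ [ i ] ⟫) (ℤ.- i) (subst (+ p ∣_) (regroup ⟪ [ i ] ⟫ i) (∣m⇒∣-m (⟪[]⟫ i))))
    where
    regroup : ∀ r i → ℤ.- (r ℤ.- i) ≡ (ℤ.- r) ℤ.- (ℤ.- i)
    regroup = solve-∀

  private
    -- Every element is the residue of its representative, so the ring laws descend from the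
    -- integers.
    lift₁ : {P : F → Set} → (∀ i → P [ i ]) → ∀ a → P a
    lift₁ {P} h a = subst P ([]-⟪⟫ a) (h ⟪ a ⟫)

    lift₃ : {P : F → F → F → Set} → (∀ i j k → P [ i ] [ j ] [ k ]) → ∀ a b c → P a b c
    lift₃ {P} h a b c = lift₁ {λ a → P a b c} (λ i → lift₁ {λ b → P [ i ] b c} (λ j → lift₁ {P [ i ] [ j ]} (h i j) c) b) a

    +-[] : ∀ i j → [ i ] + [ j ] ≡ [ i ℤ.+ j ]
    +-[] i j = sym ([]-+ i j)
    *-[] : ∀ i j → [ i ] * [ j ] ≡ [ i ℤ.* j ]
    *-[] i j = sym ([]-* i j)

    +-comm : ∀ a b → a + b ≡ b + a
    +-comm a b = cong [_] (ℤ.+-comm ⟪ a ⟫ ⟪ b ⟫)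
    *-comm : ∀ a b → a * b ≡ b * a
    *-comm a b = cong [_] (ℤ.*-comm ⟪ a ⟫ ⟪ b ⟫)

    +-assoc : ∀ a b c → (a + b) + c ≡ a + (b + c)
    +-assoc = lift₃ λ i j k → trans (cong (λ x → x + [ k ]) (+-[] i j)) (trans (+-[] (i ℤ.+ j) k)
      (trans (cong [_] (ℤ.+-assoc i j k)) (trans ([]-+ i (j ℤ.+ k)) (cong (λ x → [ i ] + x) ([]-+ j k)))))
    *-assoc : ∀ a b c → (a * b) * c ≡ a * (b * c)
    *-assoc = lift₃ λ i j k → trans (cong (λ x → x * [ k ]) (*-[] i j)) (trans (*-[] (i ℤ.* j) k)
      (trans (cong [_] (ℤ.*-assoc i j k)) (trans ([]-* i (j ℤ.* k)) (cong (λ x → [ i ] * x) ([]-* j k)))))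
    +-identityˡ : ∀ a → 0# + a ≡ a
    +-identityˡ = lift₁ λ i → trans (+-[] (+ 0) i) (cong [_] (ℤ.+-identityˡ i))
    *-identityˡ : ∀ a → 1# * a ≡ a
    *-identityˡ = lift₁ λ i → trans (*-[] (+ 1) i) (cong [_] (ℤ.*-identityˡ i))
    +-inverseˡ : ∀ a → - a + a ≡ 0#
    +-inverseˡ = lift₁ λ i → trans (cong (λ x → x + [ i ]) (sym ([]-neg i))) (trans (+-[] (ℤ.- i) i) (cong [_] (ℤ.+-inverseˡ i)))
    distribˡ : ∀ a b c → a * (b + c) ≡ a * b + a * c
    distribˡ = lift₃ λ i j k → trans (cong (λ x → [ i ] * x) (+-[] j k)) (trans (*-[] i (j ℤ.+ k))
      (trans (cong [_] (ℤ.*-distribˡ-+ i j k)) (trans ([]-+ (i ℤ.* j) (i ℤ.* k)) (cong₂ _+_ ([]-* i j) ([]-* i k)))))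

  F-commutativeRing : CommutativeRing 0ℓ 0ℓ
  F-commutativeRing = record
    { Carrier = F ; _≈_ = _≡_ ; _+_ = _+_ ; _*_ = _*_ ; -_ = λ a → - a ; 0# = 0# ; 1# = 1#
    ; isCommutativeRing = record
      { isRing = record
        { +-isAbelianGroup = record
          { isGroup = record
            { isMonoid = record
              { isSemigroup = record
                { isMagma = record { isEquivalence = isEquivalence ; ∙-cong = cong₂ _+_ }
                ; assoc = +-assoc }
              ; identity = +-identityˡ , λ a → trans (+-comm a 0#) (+-identityˡ a) }
            ; inverse = +-inverseˡ , λ a → trans (+-comm a (- a)) (+-inverseˡ a)
            ; ⁻¹-cong = cong (λ a → - a) }
          ; comm = +-comm }
        ; *-cong = cong₂ _*_
        ; *-assoc = *-assoc
        ; *-identity = *-identityˡ , λ a → trans (*-comm a 1#) (*-identityˡ a)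
        ; distrib = distribˡ , λ a b c → trans (*-comm (b + c) a)
            (trans (distribˡ a b c) (cong₂ _+_ (*-comm a b) (*-comm a c))) }
      ; *-comm = *-comm } }

  -- Integer coefficients, so that normalisation sees 1 - 1 = 0 although p is a variable.
  private
    F-almostCommutativeRing = fromCommutativeRing F-commutativeRing

    reduction : ℤ.+-*-rawRing -Raw-AlmostCommutative⟶ F-almostCommutativeRing
    reduction = record
      { ⟦_⟧ = [_] ; +-homo = []-+ ; *-homo = []-* ; -‿homo = []-neg ; 0-homo = refl ; 1-homo = refl }

    coefficients-equal : ∀ i j → Maybe ([ i ] ≡ [ j ])
    coefficients-equal i j = Maybe.map (cong [_]) (dec⇒maybe (i ℤ.≟ j))

  module Solver = Algebra.Solver.Ring ℤ.+-*-rawRing F-almostCommutativeRing reduction coefficients-equal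

  open Solver using (solve; _:=_; _:+_; _:*_; _:-_; :-_; con)

  zeroʳ : ∀ a → a * 0# ≡ 0#
  zeroʳ = solve 1 (λ a → a :* con (+ 0) := con (+ 0)) refl

  zeroˡ : ∀ a → 0# * a ≡ 0#
  zeroˡ = solve 1 (λ a → con (+ 0) :* a := con (+ 0)) refl

  private
    toℕ-0# : toℕ 0# ≡ 0
    toℕ-0# = trans (Fin.toℕ-fromℕ< (n%ℕd<d (+ 0) p)) (ℕ.m<n⇒m%n≡m (ℕ.>-nonZero⁻¹ p))

    inverse : ∀ a → a ≢ 0# → ∃ λ b → a * b ≡ 1#
    inverse a a≢0 = go (coprime-Bézout (prime⇒coprime p-prime {{ℕ.≢-nonZero nz}} (Fin.toℕ<n a)))
      where
      nz : toℕ a ≢ 0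
      nz e = a≢0 (Fin.toℕ-injective (trans e (sym toℕ-0#)))
      go : Bézout.Identity 1 p (toℕ a) → ∃ λ b → a * b ≡ 1#
      go (Bézout.+- x y eq) = [ ℤ.- + y ] , trans (cong (_* [ ℤ.- + y ]) (sym ([]-⟪⟫ a))) (trans (sym ([]-* ⟪ a ⟫ (ℤ.- + y)))
        ([]-cong (⟪ a ⟫ ℤ.* (ℤ.- + y)) (+ 1) (divides (ℤ.- + x) (begin
          ⟪ a ⟫ ℤ.* (ℤ.- + y) ℤ.- + 1        ≡⟨ rearrange ⟪ a ⟫ (+ y) ⟩
          ℤ.- (+ 1 ℤ.+ + y ℤ.* ⟪ a ⟫)        ≡⟨ cong (λ i → ℤ.- (+ 1 ℤ.+ i)) (sym (ℤ.pos-* y (toℕ a))) ⟩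
          ℤ.- (+ (1 ℕ.+ y ℕ.* toℕ a))        ≡⟨ cong (λ i → ℤ.- (+ i)) eq ⟩
          ℤ.- (+ (x ℕ.* p))                  ≡⟨ cong ℤ.-_ (ℤ.pos-* x p) ⟩
          ℤ.- (+ x ℤ.* + p)                  ≡⟨ ℤ.neg-distribˡ-* (+ x) (+ p) ⟩
          ℤ.- + x ℤ.* + p                    ∎))))
        where
        open ≡-Reasoning
        rearrange : ∀ a y → a ℤ.* (ℤ.- y) ℤ.- + 1 ≡ ℤ.- (+ 1 ℤ.+ y ℤ.* a)
        rearrange = solve-∀
      go (Bézout.-+ x y eq) = [ + y ] , trans (cong (_* [ + y ]) (sym ([]-⟪⟫ a))) (trans (sym ([]-* ⟪ a ⟫ (+ y)))
        ([]-cong (⟪ a ⟫ ℤ.* + y) (+ 1) (divides (+ x) (begin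
          ⟪ a ⟫ ℤ.* + y ℤ.- + 1                ≡⟨ cong (ℤ._- + 1) (ℤ.*-comm ⟪ a ⟫ (+ y)) ⟩
          + y ℤ.* ⟪ a ⟫ ℤ.- + 1                ≡⟨ cong (ℤ._- + 1) (sym (ℤ.pos-* y (toℕ a))) ⟩
          + (y ℕ.* toℕ a) ℤ.- + 1              ≡⟨ cong (λ i → + i ℤ.- + 1) (sym eq) ⟩
          (+ 1 ℤ.+ + (x ℕ.* p)) ℤ.- + 1        ≡⟨ rearrange (+ (x ℕ.* p)) ⟩
          + (x ℕ.* p)                          ≡⟨ ℤ.pos-* x p ⟩
          + x ℤ.* + p                          ∎))))
        where
        open ≡-Reasoning
        rearrange : ∀ x → (+ 1 ℤ.+ x) ℤ.- + 1 ≡ x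
        rearrange = solve-∀

  infix 9 _⁻¹

  -- The convention that 0 is its own inverse makes inversion an involution of the whole field, so
  -- that conjugating by `a ↦ (a - t) ⁻¹` makes sense at the pole `t` as well.
  _⁻¹ : F → F
  a ⁻¹ with a Fin.≟ 0#
  ... | yes _   = 0#
  ... | no  a≢0 = proj₁ (inverse a a≢0)

  0⁻¹ : 0# ⁻¹ ≡ 0#
  0⁻¹ with 0# Fin.≟ 0#
  ... | yes _   = refl
  ... | no  0≢0 = contradiction refl 0≢0

  *-inverseʳ : ∀ {a} → a ≢ 0# → a * a ⁻¹ ≡ 1#
  *-inverseʳ {a} a≢0 with a Fin.≟ 0#
  ... | yes a≡0 = contradiction a≡0 a≢0
  ... | no  a≢0 = proj₂ (inverse a a≢0)

  1≢0 : 1# ≢ 0#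
  1≢0 e = contradiction (trans (sym (ℕ.m<n⇒m%n≡m 1<p)) (trans (sym (Fin.toℕ-fromℕ< (n%ℕd<d (+ 1) p))) (trans (cong toℕ e) toℕ-0#))) λ ()
    where
    1<p : 1 ℕ.< p
    1<p = ℕ.nonTrivial⇒n>1 p {{prime⇒nonTrivial p-prime}}

  *-cancelˡ : ∀ {a b c} → a ≢ 0# → a * b ≡ a * c → b ≡ c
  *-cancelˡ {a} {b} {c} a≢0 e = begin
    b               ≡⟨ sym (undo b) ⟩
    a ⁻¹ * (a * b)  ≡⟨ cong (a ⁻¹ *_) e ⟩
    a ⁻¹ * (a * c)  ≡⟨ undo c ⟩
    c               ∎
    where
    open ≡-Reasoning
    undo : ∀ x → a ⁻¹ * (a * x) ≡ x
    undo x = trans (solve 3 (λ i a x → i :* (a :* x) := (a :* i) :* x) refl (a ⁻¹) a x)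
      (trans (cong (_* x) (*-inverseʳ a≢0)) (*-identityˡ x))

  *-≢0 : ∀ {a b} → a ≢ 0# → b ≢ 0# → a * b ≢ 0#
  *-≢0 {a} a≢0 b≢0 e = b≢0 (*-cancelˡ a≢0 (trans e (sym (zeroʳ a))))

  ⁻¹-≢0 : ∀ {a} → a ≢ 0# → a ⁻¹ ≢ 0#
  ⁻¹-≢0 {a} a≢0 e = 1≢0 (trans (sym (*-inverseʳ a≢0)) (trans (cong (a *_) e) (zeroʳ a)))

  ⁻¹-involutive : ∀ a → a ⁻¹ ⁻¹ ≡ a
  ⁻¹-involutive a = by-cases (a Fin.≟ 0#)
    where
    by-cases : Dec (a ≡ 0#) → a ⁻¹ ⁻¹ ≡ a
    by-cases (yes refl) = trans (cong _⁻¹ 0⁻¹) 0⁻¹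
    by-cases (no a≢0)   = *-cancelˡ (⁻¹-≢0 a≢0) (trans (*-inverseʳ (⁻¹-≢0 a≢0))
                            (sym (trans (*-comm (a ⁻¹) a) (*-inverseʳ a≢0))))

  -≡0⇒≡ : ∀ {a b} → a - b ≡ 0# → a ≡ b
  -≡0⇒≡ {a} {b} e = trans (solve 2 (λ a b → a := (a :- b) :+ b) refl a b) (trans (cong (_+ b) e) (+-identityˡ b))

  -≢0 : ∀ {a b} → a ≢ b → a - b ≢ 0#
  -≢0 a≢b e = a≢b (-≡0⇒≡ e)

-- Quasigroups on a line and their gluing over the affine plane.

module Plane (p : ℕ) (p-prime : Prime p) where
  open import Data.Integer using (+_)
  open PrimeField p p-prime
  open Solver using (solve; _:=_; _:+_; _:*_; _:-_; :-_; con)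

  op : F → F → F → F → F
  op t c a b = ((1# - c) * (a - t) ⁻¹ + c * (b - t) ⁻¹) ⁻¹ + t

  op-swap : ∀ t c a b → op t c a b ≡ op t (1# - c) b a
  op-swap t c a b = cong (λ w → w ⁻¹ + t)
    (solve 3 (λ c A B → (con (+ 1) :- c) :* A :+ c :* B := (con (+ 1) :- (con (+ 1) :- c)) :* B :+ (con (+ 1) :- c) :* A)
      refl c ((a - t) ⁻¹) ((b - t) ⁻¹))

  op-idem : ∀ t c a → op t c a a ≡ a
  op-idem t c a = begin
    ((1# - c) * (a - t) ⁻¹ + c * (a - t) ⁻¹) ⁻¹ + t
      ≡⟨ cong (λ w → w ⁻¹ + t) (solve 2 (λ c A → (con (+ 1) :- c) :* A :+ c :* A := A) refl c ((a - t) ⁻¹)) ⟩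
    (a - t) ⁻¹ ⁻¹ + t  ≡⟨ cong (_+ t) (⁻¹-involutive (a - t)) ⟩
    a - t + t          ≡⟨ solve 2 (λ a t → a :- t :+ t := a) refl a t ⟩
    a                  ∎
    where open ≡-Reasoning

  -- In the coordinate `(a - t) ⁻¹` the product goes the fraction `c` of the way from `a` to `b`;
  -- going the fraction `c ⁻¹` of the way from `a` to the product ends at `b`.
  op-cancel : ∀ t {c} → c ≢ 0# → ∀ a b → op t (c ⁻¹) a (op t c a b) ≡ b
  op-cancel t {c} c≢0 a b = begin
    ((1# - d) * A + d * (w ⁻¹ + t - t) ⁻¹) ⁻¹ + t
      ≡⟨ cong (λ x → ((1# - d) * A + d * x ⁻¹) ⁻¹ + t) (solve 2 (λ w t → w :+ t :- t := w) refl (w ⁻¹) t) ⟩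
    ((1# - d) * A + d * w ⁻¹ ⁻¹) ⁻¹ + t
      ≡⟨ cong (λ x → ((1# - d) * A + d * x) ⁻¹ + t) (⁻¹-involutive w) ⟩
    ((1# - d) * A + d * w) ⁻¹ + t
      ≡⟨ cong (λ x → x ⁻¹ + t) (solve 4 (λ c d A B → (con (+ 1) :- d) :* A :+ d :* ((con (+ 1) :- c) :* A :+ c :* B)
            := A :- (c :* d) :* A :+ (c :* d) :* B) refl c d A B) ⟩
    (A - (c * d) * A + (c * d) * B) ⁻¹ + t
      ≡⟨ cong (λ x → (A - x * A + x * B) ⁻¹ + t) (*-inverseʳ c≢0) ⟩
    (A - 1# * A + 1# * B) ⁻¹ + t
      ≡⟨ cong (λ x → x ⁻¹ + t) (solve 2 (λ A B → A :- con (+ 1) :* A :+ con (+ 1) :* B := B) refl A B) ⟩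
    (b - t) ⁻¹ ⁻¹ + t   ≡⟨ cong (_+ t) (⁻¹-involutive (b - t)) ⟩
    b - t + t           ≡⟨ solve 2 (λ a t → a :- t :+ t := a) refl b t ⟩
    b                   ∎
    where
    open ≡-Reasoning
    A = (a - t) ⁻¹
    B = (b - t) ⁻¹
    d = c ⁻¹
    w = (1# - c) * A + c * B

  -- By idempotence `a` times `a` is `a`, so cancellation excludes any other right factor. This
  -- keeps the abscissa of a product off that of its left factor, so both still span the same line.
  op-≢ : ∀ t {c} → c ≢ 0# → ∀ {a b} → a ≢ b → a ≢ op t c a b
  op-≢ t {c} c≢0 {a} {b} a≢b e = a≢b (begin
    a                            ≡⟨ sym (op-idem t (c ⁻¹) a) ⟩
    op t (c ⁻¹) a a              ≡⟨ cong (op t (c ⁻¹) a) e ⟩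
    op t (c ⁻¹) a (op t c a b)   ≡⟨ op-cancel t c≢0 a b ⟩
    b                            ∎)
    where open ≡-Reasoning

  Point Line : Set
  Point = F × F
  Line  = F × F

  infix 4 _∈ℓ_

  -- The line (u , v) is the graph of a ↦ u a + v; vertical lines are treated separately.
  _∈ℓ_ : Point → Line → Set
  (a , b) ∈ℓ (u , v) = b ≡ u * a + v

  line : Point → Point → Line
  line (a , b) (a′ , b′) = let u = (b′ - b) * (a′ - a) ⁻¹ in u , b - u * a

  line-∈ˡ : ∀ x y → x ∈ℓ line x y
  line-∈ˡ (a , b) (a′ , b′) = solve 3 (λ a b u → b := u :* a :+ (b :- u :* a)) refl a b ((b′ - b) * (a′ - a) ⁻¹)

  line-∈ʳ : ∀ x y → proj₁ x ≢ proj₁ y → y ∈ℓ line x y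
  line-∈ʳ (a , b) (a′ , b′) a≢a′ = sym (begin
    (b′ - b) * (a′ - a) ⁻¹ * a′ + (b - (b′ - b) * (a′ - a) ⁻¹ * a)
      ≡⟨ solve 5 (λ a b a′ b′ i → (b′ :- b) :* i :* a′ :+ (b :- (b′ :- b) :* i :* a) := (b′ :- b) :* ((a′ :- a) :* i) :+ b)
           refl a b a′ b′ ((a′ - a) ⁻¹) ⟩
    (b′ - b) * ((a′ - a) * (a′ - a) ⁻¹) + b
      ≡⟨ cong (λ x → (b′ - b) * x + b) (*-inverseʳ (-≢0 (a≢a′ ∘ sym))) ⟩
    (b′ - b) * 1# + b
      ≡⟨ solve 2 (λ b b′ → (b′ :- b) :* con (+ 1) :+ b := b′) refl b b′ ⟩
    b′ ∎)
    where open ≡-Reasoning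

  line-unique : ∀ x y ℓ m → proj₁ x ≢ proj₁ y → x ∈ℓ ℓ → y ∈ℓ ℓ → x ∈ℓ m → y ∈ℓ m → ℓ ≡ m
  line-unique (a , b) (a′ , b′) (u , v) (u′ , v′) a≢a′ xℓ yℓ xm ym = cong₂ _,_ u≡u′ v≡v′
    where
    open ≡-Reasoning
    slope : ∀ {u v} → b ≡ u * a + v → b′ ≡ u * a′ + v → (a - a′) * u ≡ b - b′
    slope {u} {v} e e′ = trans (solve 4 (λ a a′ u v → (a :- a′) :* u := (u :* a :+ v) :- (u :* a′ :+ v)) refl a a′ u v)
      (sym (cong₂ _-_ e e′))
    u≡u′ : u ≡ u′
    u≡u′ = *-cancelˡ (-≢0 a≢a′) (trans (slope xℓ yℓ) (sym (slope xm ym)))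
    v≡v′ : v ≡ v′
    v≡v′ = begin
      v                    ≡⟨ solve 3 (λ a u v → v := (u :* a :+ v) :- u :* a) refl a u v ⟩
      (u * a + v) - u * a  ≡⟨ cong₂ (λ b u → b - u * a) (trans (sym xℓ) xm) u≡u′ ⟩
      (u′ * a + v′) - u′ * a ≡⟨ sym (solve 3 (λ a u v → v := (u :* a :+ v) :- u :* a) refl a u′ v′) ⟩
      v′                   ∎

  lift : Line → F → Point
  lift (u , v) a = a , u * a + v

  lift-proj₁ : ∀ ℓ x → x ∈ℓ ℓ → lift ℓ (proj₁ x) ≡ x
  lift-proj₁ ℓ (a , b) x∈ℓ = cong (a ,_) (sym x∈ℓ)

  -- All vertical lines share the parameters stored at the line `(0# , 0#)`, with the ordinate as
  -- coordinate; hits are sought on the other lines only.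
  mul′ : (T C : Line → F) (x y : Point) → Dec (proj₁ x ≡ proj₁ y) → Point
  mul′ T C (a , b) (a′ , b′) (yes _) = a , op (T (0# , 0#)) (C (0# , 0#)) b b′
  mul′ T C x y (no _) = let ℓ = line x y in lift ℓ (op (T ℓ) (C ℓ) (proj₁ x) (proj₁ y))

  mul : (T C : Line → F) → Point → Point → Point
  mul T C x y = mul′ T C x y (proj₁ x Fin.≟ proj₁ y)

  mul-vertical : ∀ T C a b b′ → mul T C (a , b) (a , b′) ≡ (a , op (T (0# , 0#)) (C (0# , 0#)) b b′)
  mul-vertical T C a b b′ with a Fin.≟ a
  ... | yes _   = refl
  ... | no  a≢a = contradiction refl a≢a

  mul-line : ∀ T C x y ℓ → proj₁ x ≢ proj₁ y → x ∈ℓ ℓ → y ∈ℓ ℓ →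
    mul T C x y ≡ lift ℓ (op (T ℓ) (C ℓ) (proj₁ x) (proj₁ y))
  mul-line T C x y ℓ a≢a′ x∈ℓ y∈ℓ with proj₁ x Fin.≟ proj₁ y
  ... | yes a≡a′ = contradiction a≡a′ a≢a′
  ... | no  _    = cong (λ m → lift m (op (T m) (C m) (proj₁ x) (proj₁ y)))
    (line-unique x y (line x y) ℓ a≢a′ (line-∈ˡ x y) (line-∈ʳ x y a≢a′) x∈ℓ y∈ℓ)

  -- By `op-≢` the second product is formed on the line of the first. Leaving `D` free, subject to a
  -- pointwise equation, lets `mul-bijective` exchange `C` and `D` and so obtain both injectivity
  -- and surjectivity.
  mul-cancel : ∀ T C D → (∀ ℓ → C ℓ ≢ 0#) → (∀ ℓ → D ℓ ≡ C ℓ ⁻¹) → ∀ x y → mul T D x (mul T C x y) ≡ y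
  mul-cancel T C D C≢0 D≡ x@(a , b) y@(a′ , b′) = by-cases (a Fin.≟ a′)
    where
    open ≡-Reasoning
    o = (0# , 0#)
    by-cases : Dec (a ≡ a′) → mul T D x (mul T C x y) ≡ y
    by-cases (yes refl) = begin
      mul T D x (mul T C x y)                        ≡⟨ cong (mul T D x) (mul-vertical T C a b b′) ⟩
      mul T D x (a , op (T o) (C o) b b′)            ≡⟨ mul-vertical T D a b _ ⟩
      (a , op (T o) (D o) b (op (T o) (C o) b b′))   ≡⟨ cong (λ d → a , op (T o) d b (op (T o) (C o) b b′)) (D≡ o) ⟩
      (a , op (T o) (C o ⁻¹) b (op (T o) (C o) b b′)) ≡⟨ cong (a ,_) (op-cancel (T o) (C≢0 o) b b′) ⟩
      (a , b′) ∎
    by-cases (no a≢a′) = begin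
      mul T D x (mul T C x y)            ≡⟨ cong (mul T D x) (mul-line T C x y ℓ a≢a′ (line-∈ˡ x y) (line-∈ʳ x y a≢a′)) ⟩
      mul T D x (lift ℓ (op t c a a′))   ≡⟨ mul-line T D x (lift ℓ (op t c a a′)) ℓ (op-≢ t (C≢0 ℓ) a≢a′) (line-∈ˡ x y) refl ⟩
      lift ℓ (op t (D ℓ) a (op t c a a′)) ≡⟨ cong (λ d → lift ℓ (op t d a (op t c a a′))) (D≡ ℓ) ⟩
      lift ℓ (op t (c ⁻¹) a (op t c a a′)) ≡⟨ cong (lift ℓ) (op-cancel t (C≢0 ℓ) a a′) ⟩
      lift ℓ a′                          ≡⟨ lift-proj₁ ℓ y (line-∈ʳ x y a≢a′) ⟩
      y ∎
      where
      ℓ = line x y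
      t = T ℓ
      c = C ℓ

  -- Reduces columns to rows: exchanging the factors turns `c` into `1 - c`, and the condition
  -- `c ≢ 1` into `1 - c ≢ 0`.
  mul-swap : ∀ T C x y → mul T C x y ≡ mul T (λ ℓ → 1# - C ℓ) y x
  mul-swap T C x@(a , b) y@(a′ , b′) = by-cases (a Fin.≟ a′)
    where
    open ≡-Reasoning
    o = (0# , 0#)
    by-cases : Dec (a ≡ a′) → mul T C x y ≡ mul T (λ ℓ → 1# - C ℓ) y x
    by-cases (yes refl) = begin
      mul T C x y                            ≡⟨ mul-vertical T C a b b′ ⟩
      (a , op (T o) (C o) b b′)              ≡⟨ cong (a ,_) (op-swap (T o) (C o) b b′) ⟩
      (a , op (T o) (1# - C o) b′ b)         ≡⟨ sym (mul-vertical T (λ ℓ → 1# - C ℓ) a b′ b) ⟩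
      mul T (λ ℓ → 1# - C ℓ) y x             ∎
    by-cases (no a≢a′) = begin
      mul T C x y                            ≡⟨ mul-line T C x y ℓ a≢a′ (line-∈ˡ x y) (line-∈ʳ x y a≢a′) ⟩
      lift ℓ (op (T ℓ) (C ℓ) a a′)           ≡⟨ cong (lift ℓ) (op-swap (T ℓ) (C ℓ) a a′) ⟩
      lift ℓ (op (T ℓ) (1# - C ℓ) a′ a)
        ≡⟨ sym (mul-line T (λ ℓ → 1# - C ℓ) y x ℓ (a≢a′ ∘ sym) (line-∈ʳ x y a≢a′) (line-∈ˡ x y)) ⟩
      mul T (λ ℓ → 1# - C ℓ) y x             ∎
      where ℓ = line x y

  mul-bijective : ∀ T C → (∀ ℓ → C ℓ ≢ 0#) → ∀ x → Bijective _≡_ _≡_ (mul T C x)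
  mul-bijective T C C≢0 x = inj , λ z → mul T D x z , λ e → trans (cong (mul T C x) e)
      (mul-cancel T D C (λ ℓ → ⁻¹-≢0 (C≢0 ℓ)) (λ ℓ → sym (⁻¹-involutive (C ℓ))) x z)
    where
    D = λ ℓ → C ℓ ⁻¹
    inj : Injective _≡_ _≡_ (mul T C x)
    inj {y} {z} e = trans (sym (mul-cancel T C D C≢0 (λ _ → refl) x y))
      (trans (cong (mul T D x) e) (mul-cancel T C D C≢0 (λ _ → refl) x z))

  mul-bijectiveˡ : ∀ T C → (∀ ℓ → C ℓ ≢ 1#) → ∀ y → Bijective _≡_ _≡_ (λ x → mul T C x y)
  mul-bijectiveˡ T C C≢1 y = inj , λ z → proj₁ (surj z) , λ e → trans (mul-swap T C _ y) (proj₂ (surj z) e)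
    where
    bij = mul-bijective T (λ ℓ → 1# - C ℓ) (λ ℓ → -≢0 (C≢1 ℓ ∘ sym)) y
    surj = proj₂ bij
    inj : Injective _≡_ _≡_ (λ x → mul T C x y)
    inj {w} {x} e = proj₁ bij (trans (sym (mul-swap T C w y)) (trans e (mul-swap T C x y)))

  n : ℕ
  n = p ℕ.* p

  point : Fin n → Point
  point = remQuot p

  index : Point → Fin n
  index (a , b) = combine a b

  point-index : ∀ x → point (index x) ≡ x
  point-index (a , b) = Fin.remQuot-combine a b

  index-point : ∀ i → index (point i) ≡ i
  index-point = Fin.combine-remQuot {p} p

  private
    transport-bijective : ∀ {f : Point → Point} → Bijective _≡_ _≡_ f → Bijective _≡_ _≡_ (index ∘ f ∘ point)
    transport-bijective {f} (inj , surj) =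
      (λ {i} {j} e → point-injective (inj (index-injective e))) ,
      λ k → index (proj₁ (surj (point k))) ,
        λ {e → trans (cong index (proj₂ (surj (point k)) (trans (cong point e) (point-index _)))) (index-point k)}
      where
      point-injective : ∀ {i j} → point i ≡ point j → i ≡ j
      point-injective {i} {j} e = trans (sym (index-point i)) (trans (cong index e) (index-point j))
      index-injective : ∀ {x y} → index x ≡ index y → x ≡ y
      index-injective {x} {y} e = trans (sym (point-index x)) (trans (cong point e) (point-index y))

  latin : (T C : Line → F) → (∀ ℓ → C ℓ ≢ 0#) → (∀ ℓ → C ℓ ≢ 1#) → LatinSquare n
  latin T C C≢0 C≢1 = record
    { entry  = λ i j → index (mul T C (point i) (point j))
    ; rowBij = λ i → transport-bijective (mul-bijective T C C≢0 (point i))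
    ; colBij = λ j → transport-bijective (mul-bijectiveˡ T C C≢1 (point j)) }

-- Parameters for which a given triple is a product.

module Hits (p : ℕ) (p-prime : Prime p) where
  open import Data.Integer using (+_)
  open PrimeField p p-prime
  open Plane p p-prime
  open Solver using (solve; _:=_; _:+_; _:*_; _:-_; :-_; con)

  Triple : Set
  Triple = F × F × F

  Distinct : Triple → Set
  Distinct (a , b , z) = a ≢ b × b ≢ z × a ≢ z

  Avoids : Triple → F → Set
  Avoids (a , b , z) t = t ≢ a × t ≢ b × t ≢ z

  avoids? : ∀ τ t → Dec (Avoids τ t)
  avoids? (a , b , z) t = ¬? (t Fin.≟ a) ×-dec ¬? (t Fin.≟ b) ×-dec ¬? (t Fin.≟ z)

  -- The condition op t c a b ≡ z with denominators cleared.
  Solves : Triple → F × F → Set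
  Solves τ@(a , b , z) (t , c) = Avoids τ t × c * ((b - a) * (z - t)) ≡ (z - a) * (b - t)

  Solves? : ∀ τ o → Dec (Solves τ o)
  Solves? τ@(a , b , z) (t , c) = avoids? τ t ×-dec (c * ((b - a) * (z - t)) Fin.≟ (z - a) * (b - t))

  -- At `c = 0` the equation would make the nonzero product `(z - a) (b - t)` vanish. With the next
  -- lemma it shows that the exclusion of degenerate coefficients loses no solution.
  Solves⇒≢0 : ∀ τ o → Distinct τ → Solves τ o → proj₂ o ≢ 0#
  Solves⇒≢0 (a , b , z) (t , c) (_ , _ , a≢z) ((_ , t≢b , _) , e) refl =
    *-≢0 (-≢0 (a≢z ∘ sym)) (-≢0 (t≢b ∘ sym)) (trans (sym e) (zeroˡ _))

  -- At `c = 1` the two sides of the equation differ by `(b - z) (a - t)`, which is nonzero.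
  Solves⇒≢1 : ∀ τ o → Distinct τ → Solves τ o → proj₂ o ≢ 1#
  Solves⇒≢1 (a , b , z) (t , c) (_ , b≢z , _) ((t≢a , _ , _) , e) refl =
    *-≢0 (-≢0 b≢z) (-≢0 (t≢a ∘ sym)) (begin
      (b - z) * (a - t)
        ≡⟨ solve 4 (λ a b z t → (b :- z) :* (a :- t) := con (+ 1) :* ((b :- a) :* (z :- t)) :- (z :- a) :* (b :- t)) refl a b z t ⟩
      1# * ((b - a) * (z - t)) - (z - a) * (b - t)
        ≡⟨ cong (λ x → x - (z - a) * (b - t)) e ⟩
      (z - a) * (b - t) - (z - a) * (b - t)
        ≡⟨ solve 1 (λ x → x :- x := con (+ 0)) refl ((z - a) * (b - t)) ⟩
      0# ∎)
    where open ≡-Reasoning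

  Solves⇒op : ∀ τ o → Solves τ o → let (a , b , z) = τ; (t , c) = o in op t c a b ≡ z
  Solves⇒op (a , b , z) (t , c) ((t≢a , t≢b , t≢z) , e) = begin
    w ⁻¹ + t              ≡⟨ cong (λ x → x ⁻¹ + t) w≡ ⟩
    (z - t) ⁻¹ ⁻¹ + t     ≡⟨ cong (_+ t) (⁻¹-involutive (z - t)) ⟩
    z - t + t             ≡⟨ solve 2 (λ z t → z :- t :+ t := z) refl z t ⟩
    z                     ∎
    where
    open ≡-Reasoning
    α = a - t
    β = b - t
    ζ = z - t
    w = (1# - c) * α ⁻¹ + c * β ⁻¹
    α≢0 : α ≢ 0#
    α≢0 = -≢0 (t≢a ∘ sym)
    β≢0 : β ≢ 0#
    β≢0 = -≢0 (t≢b ∘ sym)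
    ζ≢0 : ζ ≢ 0#
    ζ≢0 = -≢0 (t≢z ∘ sym)
    w≡ : w ≡ ζ ⁻¹
    w≡ = *-cancelˡ (*-≢0 (*-≢0 α≢0 β≢0) ζ≢0) (begin
      α * β * ζ * w
        ≡⟨ solve 6 (λ α β ζ c A B → α :* β :* ζ :* ((con (+ 1) :- c) :* A :+ c :* B)
             := (con (+ 1) :- c) :* β :* ζ :* (α :* A) :+ c :* α :* ζ :* (β :* B)) refl α β ζ c (α ⁻¹) (β ⁻¹) ⟩
      (1# - c) * β * ζ * (α * α ⁻¹) + c * α * ζ * (β * β ⁻¹)
        ≡⟨ cong₂ (λ x y → (1# - c) * β * ζ * x + c * α * ζ * y) (*-inverseʳ α≢0) (*-inverseʳ β≢0) ⟩
      (1# - c) * β * ζ * 1# + c * α * ζ * 1#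
        ≡⟨ solve 5 (λ a b z t c → (con (+ 1) :- c) :* (b :- t) :* (z :- t) :* con (+ 1) :+ c :* (a :- t) :* (z :- t) :* con (+ 1)
             := (b :- t) :* (z :- t) :- c :* ((b :- a) :* (z :- t))) refl a b z t c ⟩
      β * ζ - c * ((b - a) * ζ)
        ≡⟨ cong (λ x → β * ζ - x) e ⟩
      β * ζ - (z - a) * β
        ≡⟨ solve 4 (λ a b z t → (b :- t) :* (z :- t) :- (z :- a) :* (b :- t) := (a :- t) :* (b :- t) :* con (+ 1)) refl a b z t ⟩
      α * β * 1#
        ≡⟨ cong (α * β *_) (sym (*-inverseʳ ζ≢0)) ⟩
      α * β * (ζ * ζ ⁻¹)
        ≡⟨ solve 4 (λ α β ζ Z → α :* β :* (ζ :* Z) := α :* β :* ζ :* Z) refl α β ζ (ζ ⁻¹) ⟩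
      α * β * ζ * ζ ⁻¹ ∎)

  -- For each `t` other than `a`, `b`, `z` the equation is linear in `c` with nonzero coefficient
  -- and has a solution; the 3 accounts for the excluded poles.
  count-Solves : ∀ τ → Distinct τ → p ℕ.≤ count (λ m → Solves? τ (point m)) ℕ.+ 3
  count-Solves τ@(a , b , z) (a≢b , _ , _) = begin
    p                                              ≡⟨ sym (trans (sum-const p 1) (ℕ.*-identityʳ p)) ⟩
    sum {p} (λ _ → 1)                              ≤⟨ sum-mono cover ⟩
    sum (λ t → row t ℕ.+ (𝟙 (t Fin.≟ a) ℕ.+ (𝟙 (t Fin.≟ b) ℕ.+ 𝟙 (t Fin.≟ z))))
      ≡⟨ ∑-distrib-+ {p} _ _ ⟩
    sum row ℕ.+ sum (λ t → 𝟙 (t Fin.≟ a) ℕ.+ (𝟙 (t Fin.≟ b) ℕ.+ 𝟙 (t Fin.≟ z)))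
      ≡⟨ cong₂ ℕ._+_ (sym (sum-remQuot p p (λ o → 𝟙 (Solves? τ o))))
           (trans (∑-distrib-+ {p} _ _) (cong₂ ℕ._+_ (count-≡ a) (trans (∑-distrib-+ {p} _ _) (cong₂ ℕ._+_ (count-≡ b) (count-≡ z))))) ⟩
    count (λ m → Solves? τ (point m)) ℕ.+ 3        ∎
    where
    open ℕ.≤-Reasoning
    row : F → ℕ
    row t = sum (λ c → 𝟙 (Solves? τ (t , c)))
    cover : ∀ t → 1 ℕ.≤ row t ℕ.+ (𝟙 (t Fin.≟ a) ℕ.+ (𝟙 (t Fin.≟ b) ℕ.+ 𝟙 (t Fin.≟ z)))
    cover t = by-cases (t Fin.≟ a) (t Fin.≟ b) (t Fin.≟ z)
      where
      by-cases : (A : Dec (t ≡ a)) (B : Dec (t ≡ b)) (Z : Dec (t ≡ z)) → 1 ℕ.≤ row t ℕ.+ (𝟙 A ℕ.+ (𝟙 B ℕ.+ 𝟙 Z))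
      by-cases (yes _) _       _       = ℕ.≤-trans (ℕ.s≤s ℕ.z≤n) (ℕ.m≤n+m _ (row t))
      by-cases (no _)  (yes _) _       = ℕ.≤-trans (ℕ.s≤s ℕ.z≤n) (ℕ.m≤n+m _ (row t))
      by-cases (no _)  (no _)  (yes _) = ℕ.m≤n+m _ (row t)
      by-cases (no t≢a) (no t≢b) (no t≢z) = ℕ.≤-trans
        (ℕ.≤-trans (ℕ.≤-reflexive (sym (𝟙-yes (Solves? τ (t , c)) ((t≢a , t≢b , t≢z) , eq)))) (term≤sum (λ c → 𝟙 (Solves? τ (t , c))) c))
        (ℕ.m≤m+n (row t) 0)
        where
        d = (b - a) * (z - t)
        c = (z - a) * (b - t) * d ⁻¹
        eq : c * d ≡ (z - a) * (b - t)
        eq = trans (solve 3 (λ x d i → x :* i :* d := x :* (d :* i)) refl ((z - a) * (b - t)) d (d ⁻¹))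
          (trans (cong ((z - a) * (b - t) *_) (*-inverseʳ (*-≢0 (-≢0 (a≢b ∘ sym)) (-≢0 (t≢z ∘ sym)))))
            (solve 1 (λ x → x :* con (+ 1) := x) refl ((z - a) * (b - t))))

  Solves-unique : ∀ τ t c c′ → Distinct τ → Solves τ (t , c) → Solves τ (t , c′) → c ≡ c′
  Solves-unique (a , b , z) t c c′ (a≢b , _ , _) ((_ , _ , t≢z) , e) (_ , e′) =
    *-cancelˡ (*-≢0 (-≢0 (a≢b ∘ sym)) (-≢0 (t≢z ∘ sym)))
      (trans (solve 2 (λ d c → d :* c := c :* d) refl ((b - a) * (z - t)) c)
        (trans (trans e (sym e′)) (solve 2 (λ d c → c :* d := d :* c) refl ((b - a) * (z - t)) c′)))

  -- Divided differences: two roots give `A (x + y) + B = 0`, and comparing two such equations kills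
  -- `A`, then `B`, then `C`.
  three-roots : ∀ A B C (t : Fin 3 → F) → Injective _≡_ _≡_ t → (∀ i → A * (t i * t i) + B * t i + C ≡ 0#) →
    A ≡ 0# × B ≡ 0# × C ≡ 0#
  three-roots A B C t t-inj root = A≡0 , B≡0 , C≡0
    where
    open ≡-Reasoning
    i₀ i₁ i₂ : Fin 3
    i₀ = zero
    i₁ = suc zero
    i₂ = suc (suc zero)
    slope : ∀ i j → i ≢ j → A * (t i + t j) + B ≡ 0#
    slope i j i≢j = *-cancelˡ (-≢0 (i≢j ∘ t-inj)) (begin
      (t i - t j) * (A * (t i + t j) + B)
        ≡⟨ solve 5 (λ A B C x y → (x :- y) :* (A :* (x :+ y) :+ B) := (A :* (x :* x) :+ B :* x :+ C) :- (A :* (y :* y) :+ B :* y :+ C))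
             refl A B C (t i) (t j) ⟩
      (A * (t i * t i) + B * t i + C) - (A * (t j * t j) + B * t j + C)
        ≡⟨ cong₂ _-_ (root i) (root j) ⟩
      0# - 0#
        ≡⟨ solve 1 (λ x → con (+ 0) :- con (+ 0) := x :* con (+ 0)) refl (t i - t j) ⟩
      (t i - t j) * 0# ∎)
    A≡0 : A ≡ 0#
    A≡0 = *-cancelˡ (-≢0 ((λ ()) ∘ t-inj {i₁} {i₂})) (begin
      (t i₁ - t i₂) * A
        ≡⟨ solve 5 (λ A B x y z → (y :- z) :* A := (A :* (x :+ y) :+ B) :- (A :* (x :+ z) :+ B)) refl A B (t i₀) (t i₁) (t i₂) ⟩
      (A * (t i₀ + t i₁) + B) - (A * (t i₀ + t i₂) + B)
        ≡⟨ cong₂ _-_ (slope i₀ i₁ λ ()) (slope i₀ i₂ λ ()) ⟩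
      0# - 0#
        ≡⟨ solve 1 (λ x → con (+ 0) :- con (+ 0) := x :* con (+ 0)) refl (t i₁ - t i₂) ⟩
      (t i₁ - t i₂) * 0# ∎)
    B≡0 : B ≡ 0#
    B≡0 = begin
      B                        ≡⟨ solve 2 (λ B x → B := con (+ 0) :* x :+ B) refl B (t i₀ + t i₁) ⟩
      0# * (t i₀ + t i₁) + B   ≡⟨ cong (λ A → A * (t i₀ + t i₁) + B) (sym A≡0) ⟩
      A * (t i₀ + t i₁) + B    ≡⟨ slope i₀ i₁ (λ ()) ⟩
      0#                       ∎
    C≡0 : C ≡ 0#
    C≡0 = begin
      C                                    ≡⟨ solve 2 (λ C x → C := con (+ 0) :* (x :* x) :+ con (+ 0) :* x :+ C) refl C (t i₀) ⟩
      0# * (t i₀ * t i₀) + 0# * t i₀ + C   ≡⟨ cong₂ (λ A B → A * (t i₀ * t i₀) + B * t i₀ + C) (sym A≡0) (sym B≡0) ⟩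
      A * (t i₀ * t i₀) + B * t i₀ + C     ≡⟨ root i₀ ⟩
      0#                                   ∎

  -- Eliminating c from the two conditions leaves a quadratic in t, and the
  -- triple can be read off its coefficients.
  few-common-solutions : ∀ τ τ′ → Distinct τ → Distinct τ′ → τ ≢ τ′ →
    count (λ m → Solves? τ (point m) ×-dec Solves? τ′ (point m)) ℕ.≤ 2
  few-common-solutions τ@(a , b , z) τ′@(a′ , b′ , z′) dist@(a≢b , b≢z , a≢z) dist′@(a′≢b′ , _ , _) τ≢τ′ =
    count≤-distinct 2 (λ m → Solves? τ (point m) ×-dec Solves? τ′ (point m)) none
    where
    open ≡-Reasoning
    -- Eliminating `c` by cross-multiplication leaves `P (b - t) (z′ - t) = Q (b′ - t) (z - t)`.
    P = (z - a) * (b′ - a′)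
    Q = (z′ - a′) * (b - a)
    P≢0 : P ≢ 0#
    P≢0 = *-≢0 (-≢0 (a≢z ∘ sym)) (-≢0 (a′≢b′ ∘ sym))
    A = P - Q
    B = Q * (b′ + z) - P * (b + z′)
    C = P * (b * z′) - Q * (b′ * z)
    quadratic : ∀ t c → Solves τ (t , c) → Solves τ′ (t , c) → A * (t * t) + B * t + C ≡ 0#
    quadratic t c (_ , e) (_ , e′) = begin
      A * (t * t) + B * t + C
        ≡⟨ solve 7 (λ P Q b z b′ z′ t → (P :- Q) :* (t :* t) :+ (Q :* (b′ :+ z) :- P :* (b :+ z′)) :* t :+ (P :* (b :* z′) :- Q :* (b′ :* z))
             := P :* ((b :- t) :* (z′ :- t)) :- Q :* ((b′ :- t) :* (z :- t))) refl P Q b z b′ z′ t ⟩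
      P * ((b - t) * (z′ - t)) - Q * ((b′ - t) * (z - t))
        ≡⟨ solve 8 (λ x y y′ x′ β ζ′ β′ ζ → (x :* y′) :* (β :* ζ′) :- (x′ :* y) :* (β′ :* ζ)
             := (x :* β) :* (y′ :* ζ′) :- (x′ :* β′) :* (y :* ζ)) refl (z - a) (b - a) (b′ - a′) (z′ - a′) (b - t) (z′ - t) (b′ - t) (z - t) ⟩
      (z - a) * (b - t) * ((b′ - a′) * (z′ - t)) - (z′ - a′) * (b′ - t) * ((b - a) * (z - t))
        ≡⟨ cong₂ (λ x y → x * ((b′ - a′) * (z′ - t)) - y * ((b - a) * (z - t))) (sym e) (sym e′) ⟩
      c * ((b - a) * (z - t)) * ((b′ - a′) * (z′ - t)) - c * ((b′ - a′) * (z′ - t)) * ((b - a) * (z - t))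
        ≡⟨ solve 3 (λ c x y → c :* x :* y :- c :* y :* x := con (+ 0)) refl c ((b - a) * (z - t)) ((b′ - a′) * (z′ - t)) ⟩
      0# ∎
    -- Now `P = Q` is nonzero, so `b , z′` and `b′ , z` have equal sums and equal products. Hence
    -- `b` is `b′` or `z`, and `b ≢ z` leaves `b = b′`, then `z = z′`; finally `P = Q` is linear in
    -- `a` and `a′`.
    same : A ≡ 0# → B ≡ 0# → C ≡ 0# → τ ≡ τ′
    same A≡0 B≡0 C≡0 = cong₂ _,_ a≡a′ (cong₂ _,_ b≡b′ z≡z′)
      where
      P≡Q : P ≡ Q
      P≡Q = -≡0⇒≡ A≡0
      sums : b′ + z ≡ b + z′
      sums = *-cancelˡ P≢0 (-≡0⇒≡ (trans (cong (λ x → x * (b′ + z) - P * (b + z′)) P≡Q) B≡0))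
      products : b * z′ ≡ b′ * z
      products = *-cancelˡ P≢0 (-≡0⇒≡ (trans (cong (λ x → P * (b * z′) - x * (b′ * z)) P≡Q) C≡0))
      b≡b′ : b ≡ b′
      b≡b′ = -≡0⇒≡ (*-cancelˡ (-≢0 b≢z) (begin
        (b - z) * (b - b′)
          ≡⟨ solve 3 (λ b z b′ → (b :- z) :* (b :- b′) := b :* b :- b :* (b′ :+ z) :+ b′ :* z) refl b z b′ ⟩
        b * b - b * (b′ + z) + b′ * z
          ≡⟨ cong₂ (λ x y → b * b - b * x + y) sums (sym products) ⟩
        b * b - b * (b + z′) + b * z′
          ≡⟨ solve 3 (λ b z z′ → b :* b :- b :* (b :+ z′) :+ b :* z′ := (b :- z) :* con (+ 0)) refl b z z′ ⟩
        (b - z) * 0# ∎))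
      z≡z′ : z ≡ z′
      z≡z′ = begin
        z              ≡⟨ solve 2 (λ x z → z := (x :+ z) :- x) refl b′ z ⟩
        (b′ + z) - b′  ≡⟨ cong₂ _-_ sums (sym b≡b′) ⟩
        (b + z′) - b   ≡⟨ solve 2 (λ x z → (x :+ z) :- x := z) refl b z′ ⟩
        z′             ∎
      a≡a′ : a ≡ a′
      a≡a′ = -≡0⇒≡ (*-cancelˡ (-≢0 (b≢z ∘ sym)) (begin
        (z - b) * (a - a′)
          ≡⟨ solve 4 (λ a b z a′ → (z :- b) :* (a :- a′) := (z :- a) :* (b :- a′) :- (z :- a′) :* (b :- a)) refl a b z a′ ⟩
        (z - a) * (b - a′) - (z - a′) * (b - a)
          ≡⟨ cong₂ (λ x y → (z - a) * (x - a′) - (y - a′) * (b - a)) b≡b′ z≡z′ ⟩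
        P - Q
          ≡⟨ A≡0 ⟩
        0#
          ≡⟨ sym (zeroʳ (z - b)) ⟩
        (z - b) * 0# ∎))
    none : ∀ (f : Fin 3 → Fin n) → Injective _≡_ _≡_ f → ¬ (∀ i → Solves τ (point (f i)) × Solves τ′ (point (f i)))
    none f f-inj sol = τ≢τ′ (same (proj₁ zeros) (proj₁ (proj₂ zeros)) (proj₂ (proj₂ zeros)))
      where
      t c : Fin 3 → F
      t i = proj₁ (point (f i))
      c i = proj₂ (point (f i))
      -- A solution's `c` is determined by its `t`, so three common solutions have three different
      -- poles.
      t-inj : Injective _≡_ _≡_ t
      t-inj {i} {j} e = f-inj (trans (sym (index-point (f i))) (trans (cong index (cong₂ _,_ e
        (Solves-unique τ (t i) (c i) (c j) dist (proj₁ (sol i)) (subst (λ x → Solves τ (x , c j)) (sym e) (proj₁ (sol j))))))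
        (index-point (f j))))
      zeros = three-roots A B C t t-inj (λ i → quadratic (t i) (c i) (proj₁ (sol i)) (proj₂ (sol i)))

  many-hits : ∀ {κ} (τ : Fin κ → Triple) → Injective _≡_ _≡_ τ → (∀ e → Distinct (τ e)) →
    {H : Fin n → Set} (H? : Decidable H) → (∀ e m → Solves (τ e) (point m) → H m) →
    κ ℕ.* (p ℕ.∸ 3) ℕ.≤ count H? ℕ.+ κ ℕ.* (κ ℕ.* 2)
  many-hits τ τ-inj dist H? S⊆H = bonferroni (p ℕ.∸ 3) 2 (λ e m → Solves? (τ e) (point m)) H? S⊆H
    (λ e → ℕ.m≤n+o⇒m∸n≤o p 3 (ℕ.≤-trans (count-Solves (τ e) (dist e)) (ℕ.≤-reflexive (ℕ.+-comm _ 3))))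
    (λ e e′ e≢e′ → few-common-solutions (τ e) (τ e′) (dist e) (dist e′) (e≢e′ ∘ τ-inj))

-- Incidences between points and non-vertical lines.

module Incidence (p : ℕ) (p-prime : Prime p) where
  open import Data.Integer using (+_)
  open PrimeField p p-prime
  open Plane p p-prime
  open Solver using (solve; _:=_; _:+_; _:*_; _:-_; :-_; con)

  _∈ℓ?_ : ∀ x ℓ → Dec (x ∈ℓ ℓ)
  (a , b) ∈ℓ? (u , v) = b Fin.≟ u * a + v

  -- Each slope `u` leaves exactly one intercept, `b - u a`.
  lines-through : ∀ x → count (λ ℓ → x ∈ℓ? point ℓ) ≡ p
  lines-through (a , b) = begin
    count (λ ℓ → (a , b) ∈ℓ? point ℓ)
      ≡⟨ sum-remQuot p p (λ ℓ → 𝟙 ((a , b) ∈ℓ? ℓ)) ⟩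
    sum {p} (λ u → sum {p} (λ v → 𝟙 (b Fin.≟ u * a + v)))
      ≡⟨ sum-cong-≗ (λ u → trans (sum-cong-≗ (λ v → intercept u v (b Fin.≟ u * a + v) (v Fin.≟ b - u * a))) (count-≡ (b - u * a))) ⟩
    sum {p} (λ u → 1)
      ≡⟨ trans (sum-const p 1) (ℕ.*-identityʳ p) ⟩
    p ∎
    where
    open ≡-Reasoning
    intercept : ∀ u v (d : Dec (b ≡ u * a + v)) (e : Dec (v ≡ b - u * a)) → 𝟙 d ≡ 𝟙 e
    intercept u v d e = ℕ.≤-antisym
      (𝟙-mono d e λ b≡ → trans (solve 3 (λ a u v → v := (u :* a :+ v) :- u :* a) refl a u v) (cong (λ b → b - u * a) (sym b≡)))
      (𝟙-mono e d λ v≡ → trans (solve 3 (λ a b u → b := u :* a :+ (b :- u :* a)) refl a b u) (cong (λ v → u * a + v) (sym v≡)))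

  same-abscissa : ∀ {x y} ℓ → proj₁ x ≡ proj₁ y → x ∈ℓ ℓ → y ∈ℓ ℓ → x ≡ y
  same-abscissa (u , v) refl x∈ y∈ = cong (_ ,_) (trans x∈ (sym y∈))

  common-lines : ∀ x y → x ≢ y → count (λ ℓ → x ∈ℓ? point ℓ ×-dec y ∈ℓ? point ℓ) ℕ.≤ 1
  common-lines x y x≢y = count≤-distinct 1 (λ ℓ → x ∈ℓ? point ℓ ×-dec y ∈ℓ? point ℓ) λ f f-inj on →
    contradiction
      (f-inj {zero} {suc zero} (trans (sym (index-point (f zero))) (trans (cong index
        (line-unique x y _ _ (λ a≡ → x≢y (same-abscissa (point (f zero)) a≡ (proj₁ (on zero)) (proj₂ (on zero))))
          (proj₁ (on zero)) (proj₂ (on zero)) (proj₁ (on (suc zero))) (proj₂ (on (suc zero)))))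
        (index-point (f (suc zero))))))
      λ ()

  occupancy : ∀ {s} → (Fin s → Point) → Fin n → ℕ
  occupancy e ℓ = count (λ i → e i ∈ℓ? point ℓ)

  sum-occupancy : ∀ {s} (e : Fin s → Point) → sum (occupancy e) ≡ s ℕ.* p
  sum-occupancy {s} e = trans (∑-comm (λ ℓ i → 𝟙 (e i ∈ℓ? point ℓ)))
    (trans (sum-cong-≗ (λ i → lines-through (e i))) (sum-const s p))

  -- The square counts ordered pairs of points on the line. A diagonal pair lies on `p` lines and
  -- any other pair on at most one; `bound` also grants 1 to the diagonal, which yields the plain
  -- `s * s`.
  sum-occupancy² : ∀ {s} (e : Fin s → Point) → Injective _≡_ _≡_ e →
    sum (λ ℓ → occupancy e ℓ ℕ.* occupancy e ℓ) ℕ.≤ s ℕ.* p ℕ.+ s ℕ.* s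
  sum-occupancy² {s} e e-inj = begin
    sum (λ ℓ → occupancy e ℓ ℕ.* occupancy e ℓ)
      ≡⟨ sum-cong-≗ (λ ℓ → sum-* (λ i → 𝟙 (e i ∈ℓ? point ℓ)) (λ i → 𝟙 (e i ∈ℓ? point ℓ))) ⟩
    sum (λ ℓ → sum (λ i → sum (λ j → both i j ℓ)))
      ≡⟨ trans (∑-comm (λ ℓ i → sum (λ j → both i j ℓ))) (sum-cong-≗ (λ i → ∑-comm (λ ℓ j → both i j ℓ))) ⟩
    sum (λ i → sum (λ j → sum (both i j)))
      ≤⟨ sum-mono {s} (λ i → sum-mono {s} (λ j → bound i j (j Fin.≟ i))) ⟩
    sum {s} (λ i → sum {s} (λ j → 𝟙 (j Fin.≟ i) ℕ.* p ℕ.+ 1))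
      ≡⟨ sum-cong-≗ {s} (λ i → trans (∑-distrib-+ {s} (λ j → 𝟙 (j Fin.≟ i) ℕ.* p) (λ _ → 1)) (cong₂ ℕ._+_
           (trans (sym (*-distribʳ-sum p (λ j → 𝟙 (j Fin.≟ i)))) (cong (ℕ._* p) (count-≡ i))) (sum-const s 1))) ⟩
    sum {s} (λ i → 1 ℕ.* p ℕ.+ s ℕ.* 1)
      ≡⟨ trans (sum-const s _) (expand s p) ⟩
    s ℕ.* p ℕ.+ s ℕ.* s ∎
    where
    open ℕ.≤-Reasoning
    both : Fin s → Fin s → Fin n → ℕ
    both i j ℓ = 𝟙 (e i ∈ℓ? point ℓ) ℕ.* 𝟙 (e j ∈ℓ? point ℓ)
    expand : ∀ s p → s ℕ.* (1 ℕ.* p ℕ.+ s ℕ.* 1) ≡ s ℕ.* p ℕ.+ s ℕ.* s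
    expand = ℕSolver.solve-∀
    bound : ∀ i j (d : Dec (j ≡ i)) → sum (both i j) ℕ.≤ 𝟙 d ℕ.* p ℕ.+ 1
    bound i j (yes refl) = ℕ.≤-trans (sum-mono (λ ℓ → ℕ.≤-trans (ℕ.*-monoʳ-≤ (𝟙 (e i ∈ℓ? point ℓ)) (𝟙≤1 (e i ∈ℓ? point ℓ)))
        (ℕ.≤-reflexive (ℕ.*-identityʳ _))))
      (ℕ.≤-trans (ℕ.≤-reflexive (trans (lines-through (e i)) (sym (ℕ.*-identityˡ p)))) (ℕ.m≤m+n (1 ℕ.* p) 1))
    bound i j (no j≢i) = ℕ.≤-trans
      (ℕ.≤-reflexive (sum-cong-≗ (λ ℓ → sym (𝟙-× (e i ∈ℓ? point ℓ) (e j ∈ℓ? point ℓ)))))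
      (common-lines (e i) (e j) (j≢i ∘ sym ∘ e-inj))

  -- Chebyshev's inequality: the occupancy of a random line has mean 2k and variance at most 2k.
  sparse-lines : ∀ k .{{_ : NonZero k}} (e : Fin (2 ℕ.* k ℕ.* p) → Point) → Injective _≡_ _≡_ e →
    k ℕ.* count (λ ℓ → occupancy e ℓ ℕ.<? k) ℕ.≤ 2 ℕ.* n
  sparse-lines k e e-inj = ℕ.*-cancelˡ-≤ k (ℕ.+-cancelˡ-≤ (8 ℕ.* (k ℕ.* k) ℕ.* n) _ _ (begin
    8 ℕ.* (k ℕ.* k) ℕ.* n ℕ.+ k ℕ.* (k ℕ.* B)
      ≡⟨ eqˡ k p B ⟩
    4 ℕ.* k ℕ.* (s ℕ.* p) ℕ.+ k ℕ.* k ℕ.* B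
      ≡⟨ cong₂ ℕ._+_ (trans (cong (4 ℕ.* k ℕ.*_) (sym (sum-occupancy e))) (*-distribˡ-sum (4 ℕ.* k) a))
           (*-distribˡ-sum (k ℕ.* k) (λ ℓ → 𝟙 (a ℓ ℕ.<? k))) ⟩
    sum (λ ℓ → 4 ℕ.* k ℕ.* a ℓ) ℕ.+ sum (λ ℓ → k ℕ.* k ℕ.* 𝟙 (a ℓ ℕ.<? k))
      ≡⟨ sym (∑-distrib-+ {n} _ _) ⟩
    sum (λ ℓ → 4 ℕ.* k ℕ.* a ℓ ℕ.+ k ℕ.* k ℕ.* 𝟙 (a ℓ ℕ.<? k))
      ≤⟨ sum-mono (λ ℓ → deviation (a ℓ) k (a ℓ ℕ.<? k)) ⟩
    sum (λ ℓ → a ℓ ℕ.* a ℓ ℕ.+ 4 ℕ.* (k ℕ.* k))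
      ≡⟨ ∑-distrib-+ {n} _ _ ⟩
    sum (λ ℓ → a ℓ ℕ.* a ℓ) ℕ.+ sum {n} (λ ℓ → 4 ℕ.* (k ℕ.* k))
      ≤⟨ ℕ.+-mono-≤ (sum-occupancy² e e-inj) (ℕ.≤-reflexive (sum-const n (4 ℕ.* (k ℕ.* k)))) ⟩
    -- As `s = 2 k p`, the terms `s²` and `4 k² n` together match the cross term `8 k² n` on the
    -- left; what remains is `s p = k (2 n)`.
    (s ℕ.* p ℕ.+ s ℕ.* s) ℕ.+ n ℕ.* (4 ℕ.* (k ℕ.* k))
      ≡⟨ eqʳ k p ⟩
    8 ℕ.* (k ℕ.* k) ℕ.* n ℕ.+ k ℕ.* (2 ℕ.* n) ∎))
    where
    open ℕ.≤-Reasoning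
    s = 2 ℕ.* k ℕ.* p
    a = occupancy e
    B = count (λ ℓ → a ℓ ℕ.<? k)
    eqˡ : ∀ k p B → 8 ℕ.* (k ℕ.* k) ℕ.* (p ℕ.* p) ℕ.+ k ℕ.* (k ℕ.* B) ≡ 4 ℕ.* k ℕ.* (2 ℕ.* k ℕ.* p ℕ.* p) ℕ.+ k ℕ.* k ℕ.* B
    eqˡ = ℕSolver.solve-∀
    eqʳ : ∀ k p → (2 ℕ.* k ℕ.* p ℕ.* p ℕ.+ 2 ℕ.* k ℕ.* p ℕ.* (2 ℕ.* k ℕ.* p)) ℕ.+ p ℕ.* p ℕ.* (4 ℕ.* (k ℕ.* k))
            ≡ 8 ℕ.* (k ℕ.* k) ℕ.* (p ℕ.* p) ℕ.+ k ℕ.* (2 ℕ.* (p ℕ.* p))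
    eqʳ = ℕSolver.solve-∀

-- Choice of the parameters on all lines.

module Construction (p : ℕ) (p-prime : Prime p) (3≤p : 3 ℕ.≤ p) (k : ℕ) (12≤k : 12 ℕ.≤ k) where
  open import Data.Integer using (+_)
  open PrimeField p p-prime
  open Plane p p-prime
  open Hits p p-prime
  open Incidence p p-prime

  private instance
    k≢0 : NonZero k
    k≢0 = ℕ.>-nonZero (ℕ.≤-trans (s≤s z≤n) 12≤k)

  -- A part of `s` points meets a line in `2 k` points on average. On a rich line `k` points from
  -- each part form `κ` triples, and `h` is the resulting Bonferroni bound on the number of
  -- parameters producing a hit.
  s κ h : ℕ
  s = 2 ℕ.* k ℕ.* p
  κ = k ℕ.^ 3
  h = κ ℕ.* (p ℕ.∸ 3) ℕ.∸ κ ℕ.* (κ ℕ.* 2)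

  2# : F
  2# = 1# + 1#

  2≢0 : 2# ≢ 0#
  2≢0 e = contradiction (trans (sym toℕ-2) (trans (cong toℕ (trans ([]-+ (+ 1) (+ 1)) e)) toℕ-0)) λ ()
    where
    open import Data.Nat.DivMod using (m<n⇒m%n≡m)
    toℕ-2 : toℕ [ + 2 ] ≡ 2
    toℕ-2 = trans (Fin.toℕ-fromℕ< _) (m<n⇒m%n≡m {{prime⇒nonZero p-prime}} 3≤p)
    toℕ-0 : toℕ 0# ≡ 0
    toℕ-0 = trans (Fin.toℕ-fromℕ< _) (m<n⇒m%n≡m {{prime⇒nonZero p-prime}} (ℕ.≤-trans (s≤s z≤n) 3≤p))

  2≢1 : 2# ≢ 1#
  2≢1 e = 1≢0 (trans (solve 1 (λ x → x := (x :+ x) :- x) refl 1#) (trans (cong (λ x → x - 1#) e)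
    (solve 1 (λ x → x :- x := con (+ 0)) refl 1#)))
    where open Solver using (solve; _:=_; _:+_; _:-_; con)

  -- The coefficients 0 and 1 do not give quasigroups and are replaced by 2.
  admissible : F → F
  admissible c with c Fin.≟ 0# | c Fin.≟ 1#
  ... | no _  | no _  = c
  ... | yes _ | _     = 2#
  ... | no _  | yes _ = 2#

  admissible-≢0 : ∀ c → admissible c ≢ 0#
  admissible-≢0 c with c Fin.≟ 0# | c Fin.≟ 1#
  ... | no c≢0 | no _  = c≢0
  ... | yes _  | _     = 2≢0
  ... | no _   | yes _ = 2≢0

  admissible-≢1 : ∀ c → admissible c ≢ 1#
  admissible-≢1 c with c Fin.≟ 0# | c Fin.≟ 1#
  ... | no _  | no c≢1 = c≢1
  ... | yes _ | _      = 2≢1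
  ... | no _  | yes _  = 2≢1

  admissible-id : ∀ {c} → c ≢ 0# → c ≢ 1# → admissible c ≡ c
  admissible-id {c} c≢0 c≢1 with c Fin.≟ 0# | c Fin.≟ 1#
  ... | no _    | no _    = refl
  ... | yes c≡0 | _       = contradiction c≡0 c≢0
  ... | no _    | yes c≡1 = contradiction c≡1 c≢1

  U : ℕ
  U = n ℕ.^ (3 ℕ.* s)

  -- A number u below U encodes a sequence of 3 s points, read as three sets of s points.
  part : Fin U → Fin 3 → Fin s → Point
  part u c i = point (finToFun u (combine c i))

  Alive : Fin U → Set
  Alive u = Injective _≡_ _≡_ (finToFun {n} {3 ℕ.* s} u)

  alive? : Decidable Alive
  alive? u = injective? (finToFun u)

  part-≢ : ∀ {u} → Alive u → ∀ c c′ i j → c ≢ c′ → part u c i ≢ part u c′ j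
  part-≢ inj c c′ i j c≢c′ e = c≢c′ (Fin.combine-injectiveˡ c i c′ j (inj (trans (sym (index-point _)) (trans (cong index e) (index-point _)))))

  part-injective : ∀ {u} → Alive u → ∀ c → Injective _≡_ _≡_ (part u c)
  part-injective inj c {i} {j} e = Fin.combine-injectiveʳ c i c j (inj (trans (sym (index-point _)) (trans (cong index e) (index-point _))))

  c₀ c₁ c₂ : Fin 3
  c₀ = zero
  c₁ = suc zero
  c₂ = suc (suc zero)

  -- Lines and parameter pairs are both elements of `F × F`, so `Fin n` indexes the line `ℓ` as well
  -- as the parameter pair `m`.
  Hit : Fin U → Fin n → Fin n → Set
  Hit u ℓ m = ∃ λ i → ∃ λ j → ∃ λ l →
    (part u c₀ i ∈ℓ point ℓ × part u c₁ j ∈ℓ point ℓ × part u c₂ l ∈ℓ point ℓ) ×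
    op (proj₁ (point m)) (admissible (proj₂ (point m))) (proj₁ (part u c₀ i)) (proj₁ (part u c₁ j)) ≡ proj₁ (part u c₂ l)

  hit? : ∀ u ℓ → Decidable (Hit u ℓ)
  hit? u ℓ m = any? λ i → any? λ j → any? λ l →
    (part u c₀ i ∈ℓ? point ℓ ×-dec part u c₁ j ∈ℓ? point ℓ ×-dec part u c₂ l ∈ℓ? point ℓ) ×-dec
    (op (proj₁ (point m)) (admissible (proj₂ (point m))) (proj₁ (part u c₀ i)) (proj₁ (part u c₁ j)) Fin.≟ proj₁ (part u c₂ l))

  Rich : Fin U → Fin n → Set
  Rich u ℓ = ∀ c → k ℕ.≤ occupancy (part u c) ℓ

  rich? : ∀ u → Decidable (Rich u)
  rich? u ℓ = all? λ c → k ℕ.≤? occupancy (part u c) ℓ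

  -- Each part is sparse on at most `2 n / k ≤ n / 6` lines since `k ≥ 12`, so the three parts
  -- together spoil at most half of the lines.
  rich-lines : ∀ {u} → Alive u → n ℕ.≤ 2 ℕ.* count (rich? u)
  rich-lines {u} alive = ℕ.+-cancelʳ-≤ n n _ (begin
    n ℕ.+ n                                    ≡⟨ cong (n ℕ.+_) (sym (ℕ.+-identityʳ n)) ⟩
    2 ℕ.* n                                    ≤⟨ ℕ.*-monoʳ-≤ 2 cover ⟩
    2 ℕ.* (count (rich? u) ℕ.+ sum B)          ≡⟨ ℕ.*-distribˡ-+ 2 (count (rich? u)) (sum B) ⟩
    2 ℕ.* count (rich? u) ℕ.+ 2 ℕ.* sum B      ≤⟨ ℕ.+-monoʳ-≤ (2 ℕ.* count (rich? u)) few-bad ⟩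
    2 ℕ.* count (rich? u) ℕ.+ n                ∎)
    where
    open ℕ.≤-Reasoning
    sparse? : ∀ c ℓ → Dec (occupancy (part u c) ℓ ℕ.< k)
    sparse? c ℓ = occupancy (part u c) ℓ ℕ.<? k
    B : Fin 3 → ℕ
    B c = count (sparse? c)
    cover₁ : ∀ ℓ → 1 ℕ.≤ 𝟙 (rich? u ℓ) ℕ.+ sum (λ c → 𝟙 (sparse? c ℓ))
    cover₁ ℓ = by-cases (rich? u ℓ)
      where
      by-cases : (d : Dec (Rich u ℓ)) → 1 ℕ.≤ 𝟙 d ℕ.+ sum (λ c → 𝟙 (sparse? c ℓ))
      by-cases (yes _) = s≤s z≤n
      by-cases (no ¬rich) with Fin.¬∀⟶∃¬ 3 _ (λ c → k ℕ.≤? occupancy (part u c) ℓ) ¬rich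
      ... | c , k≰ = ℕ.≤-trans (ℕ.≤-reflexive (sym (𝟙-yes (sparse? c ℓ) (ℕ.≰⇒> k≰)))) (term≤sum (λ c → 𝟙 (sparse? c ℓ)) c)
    cover : n ℕ.≤ count (rich? u) ℕ.+ sum B
    cover = begin
      n                                                            ≡⟨ sym (trans (sum-const n 1) (ℕ.*-identityʳ n)) ⟩
      sum {n} (λ _ → 1)                                            ≤⟨ sum-mono cover₁ ⟩
      sum (λ ℓ → 𝟙 (rich? u ℓ) ℕ.+ sum (λ c → 𝟙 (sparse? c ℓ)))    ≡⟨ ∑-distrib-+ {n} _ _ ⟩
      count (rich? u) ℕ.+ sum (λ ℓ → sum (λ c → 𝟙 (sparse? c ℓ)))  ≡⟨ cong (count (rich? u) ℕ.+_) (∑-comm (λ ℓ c → 𝟙 (sparse? c ℓ))) ⟩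
      count (rich? u) ℕ.+ sum B                                    ∎
    few-bad : 2 ℕ.* sum B ℕ.≤ n
    few-bad = ℕ.*-cancelˡ-≤ 6 (begin
      6 ℕ.* (2 ℕ.* sum B)          ≡⟨ sym (ℕ.*-assoc 6 2 (sum B)) ⟩
      12 ℕ.* sum B                 ≤⟨ ℕ.*-monoˡ-≤ (sum B) 12≤k ⟩
      k ℕ.* sum B                  ≡⟨ *-distribˡ-sum k B ⟩
      sum (λ c → k ℕ.* B c)        ≤⟨ sum-mono (λ c → sparse-lines k (part u c) (part-injective alive c)) ⟩
      sum {3} (λ _ → 2 ℕ.* n)      ≡⟨ trans (sum-const 3 (2 ℕ.* n)) (sym (ℕ.*-assoc 3 2 n)) ⟩
      6 ℕ.* n                      ∎)

  -- On a non-vertical line the abscissa determines the point, so disjoint parts give triples of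
  -- distinct abscissas, and different choices give different triples.
  rich-hits : ∀ {u} → Alive u → ∀ ℓ → Rich u ℓ → h ℕ.≤ count (hit? u ℓ)
  rich-hits {u} alive ℓ rich = ℕ.m≤n+o⇒m∸n≤o _ (κ ℕ.* (κ ℕ.* 2)) (ℕ.≤-trans
    (many-hits τ τ-injective distinct (hit? u ℓ) solves⇒hit) (ℕ.≤-reflexive (ℕ.+-comm (count (hit? u ℓ)) _)))
    where
    chosen : ∀ c → Σ (Fin k → Fin s) λ f → Injective _≡_ _≡_ f × (∀ i → part u c (f i) ∈ℓ point ℓ)
    chosen c = distinct-representatives k (λ _ i → part u c i ∈ℓ? point ℓ) (λ _ → rich c)
    -- As `κ = k ^ 3`, an index `e` encodes one of the `k` chosen points for each part.
    pick : Fin κ → Fin 3 → Fin s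
    pick e c = proj₁ (chosen c) (finToFun {k} {3} e c)
    P : Fin κ → Fin 3 → Point
    P e c = part u c (pick e c)
    P∈ℓ : ∀ e c → P e c ∈ℓ point ℓ
    P∈ℓ e c = proj₂ (proj₂ (chosen c)) (finToFun {k} {3} e c)
    τ : Fin κ → Triple
    τ e = proj₁ (P e c₀) , proj₁ (P e c₁) , proj₁ (P e c₂)
    τ-injective : Injective _≡_ _≡_ τ
    τ-injective {e} {e′} eq = finToFun-injective {k} {3} λ c → proj₁ (proj₂ (chosen c))
      (part-injective alive c (same-abscissa (point ℓ) (coordinate c) (P∈ℓ e c) (P∈ℓ e′ c)))
      where
      coordinate : ∀ c → proj₁ (P e c) ≡ proj₁ (P e′ c)
      coordinate zero             = cong proj₁ eq
      coordinate (suc zero)       = cong (proj₁ ∘ proj₂) eq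
      coordinate (suc (suc zero)) = cong (proj₂ ∘ proj₂) eq
    P-≢ : ∀ e c c′ → c ≢ c′ → proj₁ (P e c) ≢ proj₁ (P e c′)
    P-≢ e c c′ c≢c′ eq = part-≢ alive c c′ (pick e c) (pick e c′) c≢c′ (same-abscissa (point ℓ) eq (P∈ℓ e c) (P∈ℓ e c′))
    distinct : ∀ e → Distinct (τ e)
    distinct e = P-≢ e c₀ c₁ (λ ()) , P-≢ e c₁ c₂ (λ ()) , P-≢ e c₀ c₂ (λ ())
    solves⇒hit : ∀ e m → Solves (τ e) (point m) → Hit u ℓ m
    solves⇒hit e m sol = pick e c₀ , pick e c₁ , pick e c₂ , (P∈ℓ e c₀ , P∈ℓ e c₁ , P∈ℓ e c₂) ,
      trans (cong (λ c → op (proj₁ (point m)) c (proj₁ (P e c₀)) (proj₁ (P e c₁)))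
        (admissible-id (Solves⇒≢0 (τ e) (point m) (distinct e) sol) (Solves⇒≢1 (τ e) (point m) (distinct e) sol)))
      (Solves⇒op (τ e) (point m) sol)

  -- Divided by `n ^ n`, the sum is the expected number of sequences missed on every line. A rich
  -- line is missed with probability at most `1 - h / n`, independently of the others, and every
  -- alive sequence has at least `g` rich lines.
  potential : ∀ g → 2 ℕ.* g ℕ.≤ n →
    sum (λ u → 𝟙 (alive? u) ℕ.* prod (λ ℓ → count (¬? ∘ hit? u ℓ))) ℕ.* n ℕ.^ g ℕ.≤ U ℕ.* ((n ℕ.∸ h) ℕ.^ g ℕ.* n ℕ.^ n)
  potential g 2g≤n = begin
    sum (λ u → w u) ℕ.* n ℕ.^ g                      ≡⟨ *-distribʳ-sum (n ℕ.^ g) w ⟩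
    sum (λ u → w u ℕ.* n ℕ.^ g)                      ≤⟨ sum-mono (λ u → bound u (alive? u)) ⟩
    sum {U} (λ _ → (n ℕ.∸ h) ℕ.^ g ℕ.* n ℕ.^ n)      ≡⟨ sum-const U _ ⟩
    U ℕ.* ((n ℕ.∸ h) ℕ.^ g ℕ.* n ℕ.^ n)              ∎
    where
    open ℕ.≤-Reasoning
    misses : Fin U → Fin n → ℕ
    misses u ℓ = count (¬? ∘ hit? u ℓ)
    w : Fin U → ℕ
    w u = 𝟙 (alive? u) ℕ.* prod (misses u)
    bound : ∀ u (d : Dec (Alive u)) → 𝟙 d ℕ.* prod (misses u) ℕ.* n ℕ.^ g ℕ.≤ (n ℕ.∸ h) ℕ.^ g ℕ.* n ℕ.^ n
    bound u (no _)      = z≤n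
    bound u (yes alive) = ℕ.≤-trans (ℕ.≤-reflexive (cong (ℕ._* n ℕ.^ g) (ℕ.*-identityˡ (prod (misses u)))))
      (prod-≤-count n (n ℕ.∸ h) (misses u) (rich? u) g (λ ℓ → count≤n (¬? ∘ hit? u ℓ))
        (λ ℓ rich → few-misses ℓ (rich-hits alive ℓ rich))
        (ℕ.*-cancelˡ-≤ 2 (ℕ.≤-trans 2g≤n (rich-lines alive))))
      where
      few-misses : ∀ ℓ → h ℕ.≤ count (hit? u ℓ) → misses u ℓ ℕ.≤ n ℕ.∸ h
      few-misses ℓ h≤ = ℕ.≤-trans (ℕ.≤-reflexive (sym (trans (cong (ℕ._∸ count (hit? u ℓ)) (sym (count-¬ (hit? u ℓ))))
        (ℕ.m+n∸m≡n (count (hit? u ℓ)) (misses u ℓ))))) (ℕ.∸-monoʳ-≤ n h≤)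

  construct : ∀ g → 2 ℕ.* g ℕ.≤ n → U ℕ.* (n ℕ.∸ h) ℕ.^ g ℕ.< n ℕ.^ g →
    Σ (LatinSquare n) λ L → ∀ X Y Z → 3 ℕ.* s ℕ.≤ ∣ X ∣ → 3 ℕ.* s ℕ.≤ ∣ Y ∣ → 3 ℕ.* s ℕ.≤ ∣ Z ∣ → ¬ EmptyBox L X Y Z
  construct g 2g≤n small = latin T C C≢0 C≢1 , nonempty
    where
    instance
      n^n≢0 : NonZero (n ℕ.^ n)
      n^n≢0 = ℕ.m^n≢0 n n {{ℕ.m*n≢0 p p {{p≢0}} {{p≢0}}}}
        where p≢0 = ℕ.>-nonZero (ℕ.≤-trans (s≤s z≤n) 3≤p)
    choice : Σ (Fin n → Fin n) λ f → ∀ u → Alive u → ∃ λ ℓ → Hit u ℓ (f ℓ)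
    choice = hitting-choice n alive? hit? (ℕ.*-cancelʳ-< (n ℕ.^ g) _ _ (begin-strict
      _                                        ≤⟨ potential g 2g≤n ⟩
      U ℕ.* ((n ℕ.∸ h) ℕ.^ g ℕ.* n ℕ.^ n)      ≡⟨ sym (ℕ.*-assoc U _ _) ⟩
      U ℕ.* (n ℕ.∸ h) ℕ.^ g ℕ.* n ℕ.^ n        <⟨ ℕ.*-monoˡ-< (n ℕ.^ n) small ⟩
      n ℕ.^ g ℕ.* n ℕ.^ n                      ≡⟨ ℕ.*-comm (n ℕ.^ g) (n ℕ.^ n) ⟩
      n ℕ.^ n ℕ.* n ℕ.^ g                      ∎))
      where open ℕ.≤-Reasoning
    f = proj₁ choice
    T C : Line → F
    T ℓ = proj₁ (point (f (index ℓ)))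
    C ℓ = admissible (proj₂ (point (f (index ℓ))))
    C≢0 : ∀ ℓ → C ℓ ≢ 0#
    C≢0 ℓ = admissible-≢0 (proj₂ (point (f (index ℓ))))
    C≢1 : ∀ ℓ → C ℓ ≢ 1#
    C≢1 ℓ = admissible-≢1 (proj₂ (point (f (index ℓ))))
    nonempty : ∀ X Y Z → 3 ℕ.* s ℕ.≤ ∣ X ∣ → 3 ℕ.* s ℕ.≤ ∣ Y ∣ → 3 ℕ.* s ℕ.≤ ∣ Z ∣ → ¬ EmptyBox (latin T C C≢0 C≢1) X Y Z
    nonempty X Y Z X-big Y-big Z-big empty =
      empty (index (part u c₀ i)) (index (part u c₁ j)) (in-box c₀ i) (in-box c₁ j) (subst (_∈ Z) (sym entry≡) (in-box c₂ l))
      where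
      box : Fin 3 → Subset n
      box zero             = X
      box (suc zero)       = Y
      box (suc (suc zero)) = Z
      box-big : ∀ c → 3 ℕ.* s ℕ.≤ count (_∈? box c)
      box-big zero             = ℕ.≤-trans X-big (ℕ.≤-reflexive (sym (count-∈ X)))
      box-big (suc zero)       = ℕ.≤-trans Y-big (ℕ.≤-reflexive (sym (count-∈ Y)))
      box-big (suc (suc zero)) = ℕ.≤-trans Z-big (ℕ.≤-reflexive (sym (count-∈ Z)))
      -- The three sides may overlap or coincide. Sides of size `3 s`, not `s`, ensure that `s`
      -- points can be taken from each with all `3 s` distinct.
      reps = distinct-representatives (3 ℕ.* s) (λ i → _∈? box (quotient {3} s i)) (λ i → box-big (quotient {3} s i))
      e = proj₁ reps
      u = funToFin e
      u≗e : ∀ i → finToFun u i ≡ e i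
      u≗e = Fin.finToFun-funToFin e
      alive : Alive u
      alive {i} {j} eq = proj₁ (proj₂ reps) (trans (sym (u≗e i)) (trans eq (u≗e j)))
      in-box : ∀ c i → index (part u c i) ∈ box c
      in-box c i = subst (_∈ box c) (sym (trans (index-point _) (u≗e (combine c i))))
        (subst (λ c′ → e (combine c i) ∈ box c′) (cong proj₁ (Fin.remQuot-combine c i)) (proj₂ (proj₂ reps) (combine c i)))
      hit = proj₂ choice u alive
      ℓ = point (proj₁ hit)
      i = proj₁ (proj₂ hit)
      j = proj₁ (proj₂ (proj₂ hit))
      l = proj₁ (proj₂ (proj₂ (proj₂ hit)))
      on = proj₁ (proj₂ (proj₂ (proj₂ (proj₂ hit))))
      product : op (T ℓ) (C ℓ) (proj₁ (part u c₀ i)) (proj₁ (part u c₁ j)) ≡ proj₁ (part u c₂ l)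
      product = subst (λ ℓ′ → op (proj₁ (point (f ℓ′))) (admissible (proj₂ (point (f ℓ′)))) (proj₁ (part u c₀ i)) (proj₁ (part u c₁ j))
          ≡ proj₁ (part u c₂ l)) (sym (index-point (proj₁ hit))) (proj₂ (proj₂ (proj₂ (proj₂ (proj₂ hit)))))
      entry≡ : index (mul T C (point (index (part u c₀ i))) (point (index (part u c₁ j)))) ≡ index (part u c₂ l)
      entry≡ = cong index (begin
        mul T C (point (index (part u c₀ i))) (point (index (part u c₁ j)))
          ≡⟨ cong₂ (mul T C) (point-index _) (point-index _) ⟩
        mul T C (part u c₀ i) (part u c₁ j)
          ≡⟨ mul-line T C _ _ ℓ (λ eq → part-≢ alive c₀ c₁ i j (λ ()) (same-abscissa ℓ eq (proj₁ on) (proj₁ (proj₂ on))))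
               (proj₁ on) (proj₁ (proj₂ on)) ⟩
        lift ℓ (op (T ℓ) (C ℓ) (proj₁ (part u c₀ i)) (proj₁ (part u c₁ j)))
          ≡⟨ cong (lift ℓ) product ⟩
        lift ℓ (proj₁ (part u c₂ l))
          ≡⟨ lift-proj₁ ℓ _ (proj₂ (proj₂ on)) ⟩
        part u c₂ l ∎)
        where open ≡-Reasoning

-- Large primes, logarithms and the choice of parameters.

module Numerics where
  open import Data.Nat
  open import Data.Nat.Properties
  open import Data.Nat.Divisibility using (_∣_; m≤n⇒m!∣n!; ∣m+n∣m⇒∣n; ∣1⇒≡1; ∣-trans; m∣m*n)
  open import Data.Nat.DivMod using (m≡m%n+[m/n]*n; m%n<n; m/n*n≤m)
  open import Data.Nat.Induction using (<-rec)
  open import Data.Nat.ListAction using (product)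
  open import Data.Nat.Logarithm
  open import Data.Nat.Primality.Factorisation using (PrimeFactorisation; factorise)
  open import Data.Nat.Tactic.RingSolver using (solve-∀)
  open import Data.List using ([]; _∷_)
  open import Data.List.Relation.Unary.All using (All; []; _∷_)
  open PrimeFactorisation

  prime-divisor : ∀ n → 2 ≤ n → ∃ λ p → Prime p × p ∣ n
  prime-divisor n 2≤n = go (factors F) (factorsPrime F) (isFactorisation F)
    where
    F = factorise n {{>-nonZero (≤-trans (s≤s z≤n) 2≤n)}}
    go : ∀ ps → All Prime ps → n ≡ product ps → ∃ λ p → Prime p × p ∣ n
    go []       _         n≡1 = contradiction n≡1 (>⇒≢ 2≤n)
    go (p ∷ ps) (p-pr ∷ _) n≡ = p , p-pr , subst (p ∣_) (sym n≡) (m∣m*n (product ps))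

  -- Euclid's argument: a prime up to `m` divides `m !`, hence not `m ! + 1`.
  prime-above : ∀ m → ∃ λ p → Prime p × m < p
  prime-above m with prime-divisor (m ! + 1) (+-monoˡ-≤ 1 (1≤n! m))
  ... | p , p-pr , p∣ with m <? p
  ...   | yes m<p = p , p-pr , m<p
  ...   | no  m≮p = contradiction (subst Prime (∣1⇒≡1 (∣m+n∣m⇒∣n p∣ p∣m!)) p-pr) ¬prime[1]
    where
    p∣p! : ∀ p → .{{NonZero p}} → p ∣ p !
    p∣p! (suc p) = m∣m*n (p !)
    p∣m! : p ∣ m !
    p∣m! = ∣-trans (p∣p! p {{prime⇒nonZero p-pr}}) (m≤n⇒m!∣n! (≮⇒≥ m≮p))

  n<2^[1+log₂n] : ∀ n → n < 2 ^ suc ⌊log₂ n ⌋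
  n<2^[1+log₂n] n = ≰⇒> λ 2^≤n → 1+n≰n (subst (_≤ ⌊log₂ n ⌋) (⌊log₂[2^n]⌋≡n (suc ⌊log₂ n ⌋)) (⌊log₂⌋-mono-≤ 2^≤n))

  2^log₂n≤n : ∀ n → 0 < n → 2 ^ ⌊log₂ n ⌋ ≤ n
  2^log₂n≤n = <-rec _ step
    where
    step : ∀ n → (∀ {m} → m < n → 0 < m → 2 ^ ⌊log₂ m ⌋ ≤ m) → 0 < n → 2 ^ ⌊log₂ n ⌋ ≤ n
    step 1 rec _ = ≤-refl
    step n@(suc (suc m)) rec _ = begin
      2 ^ ⌊log₂ n ⌋                   ≡⟨ cong (2 ^_) (sym (m+[n∸m]≡n 1≤log)) ⟩
      2 * 2 ^ (⌊log₂ n ⌋ ∸ 1)         ≡⟨ cong (λ l → 2 * 2 ^ l) (sym (⌊log₂⌊n/2⌋⌋≡⌊log₂n⌋∸1 n)) ⟩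
      2 * 2 ^ ⌊log₂ ⌊ n /2⌋ ⌋         ≤⟨ *-monoʳ-≤ 2 (rec (⌊n/2⌋<n (suc m)) (s≤s z≤n)) ⟩
      2 * ⌊ n /2⌋                     ≡⟨ cong (⌊ n /2⌋ +_) (+-identityʳ _) ⟩
      ⌊ n /2⌋ + ⌊ n /2⌋               ≤⟨ +-monoʳ-≤ ⌊ n /2⌋ (⌊n/2⌋≤⌈n/2⌉ n) ⟩
      ⌊ n /2⌋ + ⌈ n /2⌉               ≡⟨ ⌊n/2⌋+⌈n/2⌉≡n n ⟩
      n                               ∎
      where
      open ≤-Reasoning
      1≤log : 1 ≤ ⌊log₂ n ⌋
      1≤log = ⌊log₂⌋-mono-≤ {2} {n} (s≤s (s≤s z≤n))

  √ : ∀ m → ∃ λ r → r * r ≤ m × m < suc r * suc r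
  √ zero = 0 , z≤n , s≤s z≤n
  √ (suc m) with √ m
  ... | r , r²≤m , m<[1+r]² with suc m <? suc r * suc r
  ...   | yes lt = r , m≤n⇒m≤1+n r²≤m , lt
  ...   | no ≮  = suc r , ≮⇒≥ ≮ , ≤-<-trans m<[1+r]² (*-mono-< (n<1+n (suc r)) (n<1+n (suc r)))

  m*m≤n*n⇒m≤n : ∀ {m n} → m * m ≤ n * n → m ≤ n
  m*m≤n*n⇒m≤n {m} {n} m²≤n² = ≮⇒≥ λ n<m → <⇒≱ (*-mono-< n<m n<m) m²≤n²

  -- The bound `2 ^ 28` on `d` makes room for `8² 144³`, the constant arising in `8κ≤p`.
  cubic≤exponential : ∀ d → d ≤ 2 ^ 28 → ∀ j → 64 ≤ j → d * (suc j * suc j * suc j) ≤ 2 ^ j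
  cubic≤exponential d d≤2²⁸ j 64≤j = subst Cubic≤ (m∸n+n≡m 64≤j) (go (j ∸ 64))
    where
    Cubic≤ : ℕ → Set
    Cubic≤ j = d * (suc j * suc j * suc j) ≤ 2 ^ j
    go : ∀ i → Cubic≤ (i + 64)
    go zero    = ≤-trans (*-monoˡ-≤ (65 * 65 * 65) d≤2²⁸) (≤ᵇ⇒≤ (2 ^ 28 * (65 * 65 * 65)) (2 ^ 64) _)
    go (suc i) = ≤-trans (≤-reflexive (cong (λ a → d * (a * a * a)) (cong suc (shift i)))) (≤-trans (step (i + 58))
      (≤-trans (≤-reflexive (cong (λ a → 2 * (d * (a * a * a))) (sym (shift i)))) (*-monoʳ-≤ 2 (go i))))
      where
      shift : ∀ i → suc (i + 64) ≡ 7 + (i + 58)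
      shift = solve-∀
      -- Raising `j` by one less than doubles the cube, since already `(8 / 7)³ < 2`.
      step : ∀ b → d * ((8 + b) * (8 + b) * (8 + b)) ≤ 2 * (d * ((7 + b) * (7 + b) * (7 + b)))
      step b = ≤-trans (m≤m+n _ (d * (174 + 102 * b + 18 * (b * b) + b * b * b))) (≤-reflexive (eq d b))
        where
        eq : ∀ d b → d * ((8 + b) * (8 + b) * (8 + b)) + d * (174 + 102 * b + 18 * (b * b) + b * b * b) ≡ 2 * (d * ((7 + b) * (7 + b) * (7 + b)))
        eq = solve-∀

  ^-distrib-* : ∀ m n o → (m * n) ^ o ≡ m ^ o * n ^ o
  ^-distrib-* m n zero    = refl
  ^-distrib-* m n (suc o) = trans (cong (m * n *_) (^-distrib-* m n o)) ([m*n]*[o*p]≡[m*o]*[n*p] m n (m ^ o) (n ^ o))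

  bernoulli : ∀ w h y → w ^ suc y + suc y * h * w ^ y ≤ (w + h) ^ suc y
  bernoulli w h zero    = ≤-reflexive (eq w h)
    where
    eq : ∀ w h → w * 1 + (h + 0) * 1 ≡ (w + h) * 1
    eq = solve-∀
  bernoulli w h (suc y) = ≤-trans (subst (w ^ suc (suc y) + suc (suc y) * h * w ^ suc y ≤_) (eq w h y (w ^ y)) (m≤m+n _ _))
    (*-monoʳ-≤ (w + h) (bernoulli w h y))
    where
    eq : ∀ w h y W → w * (w * W) + (h + (h + y * h)) * (w * W) + (h + y * h) * h * W ≡ (w + h) * (w * W + (h + y * h) * W)
    eq = solve-∀

  -- With `w = N ∸ h`, the second binomial term `x h w ^ (x - 1)` of `(w + h) ^ x` is at least
  -- `N w ^ (x - 1)`, hence at least the first term `w ^ x`. This replaces `1 - t ≤ exp (- t)`.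
  doubling : ∀ N h x → 0 < N → N ≤ h * x → 2 * (N ∸ h) ^ x ≤ N ^ x
  doubling N h zero    0<N N≤ = contradiction (subst (N ≤_) (*-zeroʳ h) N≤) (<⇒≱ 0<N)
  doubling N h (suc y) 0<N N≤ with ≤-total h N
  ... | inj₂ N≤h = subst (λ w → 2 * w ^ suc y ≤ N ^ suc y) (sym (m≤n⇒m∸n≡0 N≤h)) z≤n
  ... | inj₁ h≤N = begin
    2 * w ^ suc y                         ≡⟨ cong (w ^ suc y +_) (+-identityʳ _) ⟩
    w ^ suc y + w * w ^ y                 ≤⟨ +-monoʳ-≤ (w ^ suc y) (*-monoˡ-≤ (w ^ y) (≤-trans (m∸n≤m N h) (≤-trans N≤ (≤-reflexive (*-comm h (suc y)))))) ⟩
    w ^ suc y + suc y * h * w ^ y         ≤⟨ bernoulli w h y ⟩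
    (w + h) ^ suc y                       ≡⟨ cong (_^ suc y) (m∸n+n≡m h≤N) ⟩
    N ^ suc y                             ∎
    where
    open ≤-Reasoning
    w = N ∸ h

  -- There are fewer than `2 ^ (l a)` configurations, and `x (l a)` factors split into `l a` blocks,
  -- each of which halves the expected number of survivors.
  union-bound : ∀ N h x l a → 0 < N → 0 < a → N ≤ h * x → N < 2 ^ l →
    N ^ a * (N ∸ h) ^ (x * (l * a)) < N ^ (x * (l * a))
  union-bound N h x l a 0<N 0<a N≤hx N<2^l = go (w ^ g) refl
    where
    w g : ℕ
    w = N ∸ h
    g = x * (l * a)
    instance
      N≢0 : NonZero N
      N≢0 = >-nonZero 0<N
      a≢0 : NonZero a
      a≢0 = >-nonZero 0<a
    -- Strictness comes from `N < 2 ^ l` and would be lost on multiplying by `w ^ g = 0`; in that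
    -- case it comes from `N ^ g > 0`.
    go : ∀ v → w ^ g ≡ v → N ^ a * w ^ g < N ^ g
    go zero    eq = subst (_< N ^ g) (sym (trans (cong (N ^ a *_) eq) (*-zeroʳ (N ^ a)))) (m^n>0 N g)
    go (suc v) eq = begin-strict
      N ^ a * w ^ g              <⟨ *-monoˡ-< (w ^ g) {{>-nonZero (subst (0 <_) (sym eq) (s≤s z≤n))}} (^-monoˡ-< a N<2^l) ⟩
      (2 ^ l) ^ a * w ^ g        ≡⟨ cong₂ _*_ (^-*-assoc 2 l a) (sym (^-*-assoc w x (l * a))) ⟩
      2 ^ (l * a) * (w ^ x) ^ (l * a)  ≡⟨ sym (^-distrib-* 2 (w ^ x) (l * a)) ⟩
      (2 * w ^ x) ^ (l * a)      ≤⟨ ^-monoˡ-≤ (l * a) (doubling N h x 0<N N≤hx) ⟩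
      (N ^ x) ^ (l * a)          ≡⟨ ^-*-assoc N x (l * a) ⟩
      N ^ g                      ∎
      where open ≤-Reasoning

  log-≥ : ∀ j n → 2 ^ j ≤ n → j ≤ ⌊log₂ n ⌋
  log-≥ j n 2^j≤n = subst (_≤ ⌊log₂ n ⌋) (⌊log₂[2^n]⌋≡n j) (⌊log₂⌋-mono-≤ 2^j≤n)

  -- k is chosen of order √(log n), and x of order p / k³ is the number of rich lines after
  -- which the expected number of surviving configurations has halved.
  module Parameters (p : ℕ) (λ≥64 : 64 ≤ ⌊log₂ p * p ⌋) where
    open ≤-Reasoning

    n l : ℕ
    n = p * p
    l = ⌊log₂ n ⌋

    root : ∃ λ r → r * r ≤ suc l × suc l < suc r * suc r
    root = √ (suc l)

    -- The factor 6 gives `k² ≥ 36 (l + 1)`, as `enough-lines` demands, and together with `r ≥ 1` it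
    -- gives `k ≥ 12`, as rich lines demand.
    r k κ : ℕ
    r = proj₁ root
    k = 6 * suc r
    κ = k ^ 3

    1≤r : 1 ≤ r
    1≤r = go r (proj₂ (proj₂ root))
      where
      go : ∀ r → suc l < suc r * suc r → 1 ≤ r
      go zero    (s≤s ())
      go (suc r) _ = s≤s z≤n

    12≤k : 12 ≤ k
    12≤k = *-monoʳ-≤ 6 (s≤s 1≤r)

    instance
      k≢0 : NonZero k
      k≢0 = >-nonZero (≤-trans (s≤s z≤n) 12≤k)
      κ≢0 : NonZero κ
      κ≢0 = m^n≢0 k 3

    12≤κ : 12 ≤ κ
    12≤κ = ≤-trans 12≤k (m≤m*n k (k ^ 2) {{m^n≢0 k 2}})

    36l≤k² : 36 * suc l ≤ k * k
    36l≤k² = begin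
      36 * suc l              ≤⟨ *-monoʳ-≤ 36 (<⇒≤ (proj₂ (proj₂ root))) ⟩
      36 * (suc r * suc r)    ≡⟨ eq (suc r) ⟩
      k * k                   ∎
      where
      eq : ∀ r → 36 * (r * r) ≡ 6 * r * (6 * r)
      eq = solve-∀

    k²≤144l : k * k ≤ 144 * suc l
    k²≤144l = begin
      k * k                            ≤⟨ *-mono-≤ k≤12r k≤12r ⟩
      12 * r * (12 * r)                ≡⟨ eq r ⟩
      144 * (r * r)                    ≤⟨ *-monoʳ-≤ 144 (proj₁ (proj₂ root)) ⟩
      144 * suc l                      ∎
      where
      eq : ∀ r → 12 * r * (12 * r) ≡ 144 * (r * r)
      eq = solve-∀
      k≤12r : k ≤ 12 * r
      k≤12r = begin
        6 * suc r      ≤⟨ *-monoʳ-≤ 6 (+-monoˡ-≤ r 1≤r) ⟩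
        6 * (r + r)    ≡⟨ eq′ r ⟩
        12 * r         ∎
        where
        eq′ : ∀ r → 6 * (r + r) ≡ 12 * r
        eq′ = solve-∀

    0<n : 0 < n
    0<n = go n λ≥64
      where
      go : ∀ n → 64 ≤ ⌊log₂ n ⌋ → 0 < n
      go (suc n) _ = s≤s z≤n

    -- Compared after squaring: `(8 k³)² ≤ 8² 144³ (l + 1)³ ≤ 2 ^ l ≤ p²`. It keeps the correction
    -- `2 κ²` in `h` small beside `κ p`.
    8κ≤p : 8 * κ ≤ p
    8κ≤p = m*m≤n*n⇒m≤n (≤-trans (cubed 8 144 k (suc l) k²≤144l)
      (≤-trans (cubic≤exponential (8 * 8 * (144 * 144 * 144)) (≤ᵇ⇒≤ _ _ _) l λ≥64) (2^log₂n≤n n 0<n)))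
      where
      cubed : ∀ c d k l → k * k ≤ d * l → c * k ^ 3 * (c * k ^ 3) ≤ c * c * (d * d * d) * (l * l * l)
      cubed c d k l k²≤dl = begin
        c * k ^ 3 * (c * k ^ 3)                  ≡⟨ eq c k ⟩
        c * c * (k * k * (k * k) * (k * k))      ≤⟨ *-monoʳ-≤ (c * c) (*-mono-≤ (*-mono-≤ k²≤dl k²≤dl) k²≤dl) ⟩
        c * c * (d * l * (d * l) * (d * l))      ≡⟨ eq′ c d l ⟩
        c * c * (d * d * d) * (l * l * l)        ∎
        where
        eq : ∀ c k → c * (k * (k * (k * 1))) * (c * (k * (k * (k * 1)))) ≡ c * c * (k * k * (k * k) * (k * k))
        eq = solve-∀
        eq′ : ∀ c d l → c * c * (d * l * (d * l) * (d * l)) ≡ c * c * (d * d * d) * (l * l * l)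
        eq′ = solve-∀

    κ≤p : κ ≤ p
    κ≤p = ≤-trans (m≤n*m κ 8) 8κ≤p

    3≤p : 3 ≤ p
    3≤p = ≤-trans (≤-trans (s≤s (s≤s (s≤s z≤n))) 12≤κ) κ≤p

    x h s : ℕ
    -- The 2 compensates for `h` being bounded below only by half of `κ p`; the `suc` rounds the
    -- quotient up.
    x = suc (2 * p / κ)
    h = κ * (p ∸ 3) ∸ κ * (κ * 2)
    s = 2 * k * p

    2p≤κx : 2 * p ≤ κ * x
    2p≤κx = begin
      2 * p                                ≡⟨ m≡m%n+[m/n]*n (2 * p) κ ⟩
      2 * p % κ + 2 * p / κ * κ            ≤⟨ +-monoˡ-≤ (2 * p / κ * κ) (<⇒≤ (m%n<n (2 * p) κ)) ⟩
      x * κ                                ≡⟨ *-comm x κ ⟩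
      κ * x                                ∎

    κx≤3p : κ * x ≤ 3 * p
    κx≤3p = begin
      κ * x                ≡⟨ *-comm κ x ⟩
      κ + 2 * p / κ * κ    ≤⟨ +-mono-≤ {κ} {p} κ≤p (m/n*n≤m (2 * p) κ) ⟩
      3 * p                ∎

    -- Amounts to `6 + 4 κ ≤ p`, which follows from `8 κ ≤ p` and `12 ≤ κ`.
    κp≤2h : κ * p ≤ 2 * h
    κp≤2h = subst (κ * p ≤_) (sym (*-distribˡ-∸ 2 (κ * (p ∸ 3)) (κ * (κ * 2)))) (m+n≤o⇒m≤o∸n (κ * p) (begin
      κ * p + 2 * (κ * (κ * 2))                    ≡⟨ cong (λ p → κ * p + 2 * (κ * (κ * 2))) (sym (m+[n∸m]≡n 3≤p)) ⟩
      κ * (3 + q) + 2 * (κ * (κ * 2))              ≡⟨ eq κ q ⟩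
      κ * (q + (3 + 4 * κ))                        ≤⟨ *-monoʳ-≤ κ (+-monoʳ-≤ q 3+4κ≤q) ⟩
      κ * (q + q)                                  ≡⟨ eq′ κ q ⟩
      2 * (κ * q)                                  ∎))
      where
      q = p ∸ 3
      eq : ∀ κ q → κ * (3 + q) + 2 * (κ * (κ * 2)) ≡ κ * (q + (3 + 4 * κ))
      eq = solve-∀
      eq′ : ∀ κ q → κ * (q + q) ≡ 2 * (κ * q)
      eq′ = solve-∀
      3+4κ≤q : 3 + 4 * κ ≤ q
      3+4κ≤q = +-cancelˡ-≤ 3 _ _ (begin
        6 + 4 * κ          ≤⟨ +-monoˡ-≤ (4 * κ) (≤-trans (≤ᵇ⇒≤ 6 12 _) (≤-trans 12≤κ (m≤n*m κ 4))) ⟩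
        4 * κ + 4 * κ      ≡⟨ sym (*-distribʳ-+ κ 4 4) ⟩
        8 * κ              ≤⟨ 8κ≤p ⟩
        p                  ≡⟨ sym (m+[n∸m]≡n 3≤p) ⟩
        3 + q              ∎)

    n≤hx : n ≤ h * x
    n≤hx = *-cancelˡ-≤ 2 (begin
      2 * (p * p)      ≡⟨ sym (*-assoc 2 p p) ⟩
      2 * p * p        ≤⟨ *-monoˡ-≤ p 2p≤κx ⟩
      κ * x * p        ≡⟨ eq κ x p ⟩
      κ * p * x        ≤⟨ *-monoˡ-≤ x κp≤2h ⟩
      2 * h * x        ≡⟨ *-assoc 2 h x ⟩
      2 * (h * x)      ∎)
      where
      eq : ∀ κ x p → κ * x * p ≡ κ * p * x
      eq = solve-∀

    -- The halvings must fit into half of the lines, and this fixes the order of `k`: the left side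
    -- is `12 (l + 1) x k p`, where `x k ≤ 3 p / k²`, so `k² ≥ 36 (l + 1)` is what makes it at most
    -- `p²`.
    enough-lines : 2 * (x * (suc l * (3 * s))) ≤ n
    enough-lines = begin
      2 * (x * (suc l * (3 * (2 * k * p))))  ≡⟨ eq x (suc l) k p ⟩
      12 * (suc l * (x * k)) * p             ≤⟨ *-monoˡ-≤ p (*-cancelˡ-≤ {12 * (suc l * (x * k))} {p} 3 3*) ⟩
      p * p                                  ∎
      where
      eq : ∀ x l k p → 2 * (x * (l * (3 * (2 * k * p)))) ≡ 12 * (l * (x * k)) * p
      eq = solve-∀
      eq′ : ∀ l y → 3 * (12 * (l * y)) ≡ 36 * l * y
      eq′ = solve-∀
      eq″ : ∀ k x → k * k * (x * k) ≡ k * (k * (k * 1)) * x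
      eq″ = solve-∀
      3* : 3 * (12 * (suc l * (x * k))) ≤ 3 * p
      3* = begin
        3 * (12 * (suc l * (x * k)))  ≡⟨ eq′ (suc l) (x * k) ⟩
        36 * suc l * (x * k)          ≤⟨ *-monoˡ-≤ (x * k) 36l≤k² ⟩
        k * k * (x * k)               ≡⟨ eq″ k x ⟩
        κ * x                         ≤⟨ κx≤3p ⟩
        3 * p                         ∎

    0<3s : 0 < 3 * s
    0<3s = >-nonZero⁻¹ _ {{m*n≢0 3 s {{_}} {{m*n≢0 (2 * k) p {{m*n≢0 2 k}} {{>-nonZero (≤-trans (s≤s z≤n) 3≤p)}}}}}}

    -- `10368 = 36 · 144 · 2`: the square of `6 k p` is `36 k² n`, and
    -- `k² ≤ 144 (l + 1) ≤ 144 · 2 l`.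
    side-bound : SideBound 10368 n (3 * s)
    side-bound = begin
      3 * s * (3 * s)                  ≡⟨ eq k p ⟩
      36 * (k * k) * n                 ≤⟨ *-monoˡ-≤ n (*-monoʳ-≤ 36 (≤-trans k²≤144l (*-monoʳ-≤ 144 (+-monoˡ-≤ l (≤-trans (s≤s z≤n) λ≥64))))) ⟩
      36 * (144 * (l + l)) * n         ≡⟨ eq′ l n ⟩
      10368 * (n * l)                  ∎
      where
      eq : ∀ k p → 3 * (2 * k * p) * (3 * (2 * k * p)) ≡ 36 * (k * k) * (p * p)
      eq = solve-∀
      eq′ : ∀ l n → 36 * (144 * (l + l)) * n ≡ 10368 * (n * l)
      eq′ = solve-∀

  -- Squares of large primes as orders.

  log-square-≥ : ∀ e p → 2 ^ e ≤ p → e + e ≤ ⌊log₂ p * p ⌋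
  log-square-≥ e p 2^e≤p = log-≥ (e + e) (p * p) (≤-trans (≤-reflexive (^-distribˡ-+-* 2 e e)) (*-mono-≤ 2^e≤p 2^e≤p))

  HasSmallEmptyCubes : ℕ → ℕ → Set
  HasSmallEmptyCubes C n = Σ (LatinSquare n) λ L → (X Y Z : Subset n) → IsCube X Y Z → EmptyBox L X Y Z → SideBound C n ∣ X ∣

  nonempty⇒bounded : ∀ {n} (L : LatinSquare n) C t → SideBound C n t →
    (∀ X Y Z → t ≤ ∣ X ∣ → t ≤ ∣ Y ∣ → t ≤ ∣ Z ∣ → ¬ EmptyBox L X Y Z) →
    ∀ X Y Z → IsCube X Y Z → EmptyBox L X Y Z → SideBound C n ∣ X ∣
  nonempty⇒bounded L C t bound nonempty X Y Z (X≡Y , Y≡Z) empty = ≤-trans (*-mono-≤ X≤t X≤t) bound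
    where
    X≤t : ∣ X ∣ ≤ t
    X≤t = <⇒≤ (≰⇒> λ t≤X → nonempty X Y Z t≤X (subst (t ≤_) X≡Y t≤X) (subst (t ≤_) (trans X≡Y Y≡Z) t≤X) empty)

  square-of-prime : ∀ p → Prime p → 64 ≤ ⌊log₂ p * p ⌋ → HasSmallEmptyCubes 10368 (p * p)
  square-of-prime p p-prime λ≥64 = proj₁ square , nonempty⇒bounded (proj₁ square) 10368 (3 * s) side-bound (proj₂ square)
    where
    open Parameters p λ≥64
    square = Construction.construct p p-prime 3≤p k 12≤k (x * (suc l * (3 * s))) enough-lines
      (union-bound n h x (suc l) (3 * s) 0<n 0<3s n≤hx (n<2^[1+log₂n] n))

  large-orders : ∀ C e → (∀ p → Prime p → e + e ≤ ⌊log₂ p * p ⌋ → HasSmallEmptyCubes C (p * p)) →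
    ∀ m → ∃ λ n → m ≤ n × n > 0 × HasSmallEmptyCubes C n
  large-orders C e squares m = p * p , ≤-trans m≤p (m≤m*n p p) , >-nonZero⁻¹ (p * p) {{m*n≢0 p p}} ,
    squares p p-prime (log-square-≥ e p (≤-trans (m≤n+m (2 ^ e) m) (<⇒≤ big)))
    where
    P = prime-above (m + 2 ^ e)
    p = proj₁ P
    p-prime = proj₁ (proj₂ P)
    big = proj₂ (proj₂ P)
    instance
      p≢0 : NonZero p
      p≢0 = prime⇒nonZero p-prime
    m≤p : m ≤ p
    m≤p = ≤-trans (m≤m+n m (2 ^ e)) (<⇒≤ big)

open Numerics

theorem1p6 : Σ ℕ λ C → (C > 0) × ((m : ℕ) → Σ ℕ λ n → (m ≤ n) × (n > 0) × Σ (LatinSquare n) λ L → (X Y Z : Subset n) → IsCube X Y Z → EmptyBox L X Y Z → SideBound C n ∣ X ∣)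
-- A prime above `2 ^ 32` has a square of logarithm at least `32 + 32 = 64`, the threshold of
-- `square-of-prime`.
theorem1p6 = 10368 , s≤s z≤n , large-orders 10368 32 square-of-prime
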